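{- Let $k\ge 1$, let $\mathcal{G}_1,\ldots,\mathcal{G}_k$ be ordered graphs, each containing at least one edge, let $\boldsymbol{\lambda}=(\lambda_1,\ldots,\lambda_k)\in(0,\infty)^k$, and put $R=\overline{\mathrm{R}}(\mathcal{G}_1,\ldots,\mathcal{G}_k)$, $h_i=v(\mathcal{G}_i)$, $h_*=\min_{i\in[k]}h_i$, $I_*=\{i\in[k]:h_i=h_*\}$ and $\lambda_*=\min_{j\in I_*}\lambda_j$. For $n\ge R$, the sequence $$\frac{\overline{\mathrm{M}}_{\boldsymbol{\lambda}}(n;\mathcal{G}_1,\ldots,\mathcal{G}_k)}{\binom{n}{h_*}}$$ is nondecreasing in $n$ and bounded above by $\lambda_*$. Therefore the limit $$\pi_{\boldsymbol{\lambda}}(\mathcal{G}_1,\ldots,\mathcal{G}_k):=\lim_{n\to\infty}\frac{\overline{\mathrm{M}}_{\boldsymbol{\lambda}}(n;\mathcal{G}_1,\ldots,\mathcal{G}_k)}{\binom{n}{h_*}}$$ exists and satisfies $$0<\frac{\overline{\mathrm{RM}}_{\boldsymbol{\lambda}}(\mathcal{G}_1,\ldots,\mathcal{G}_k)}{\binom{R}{h_*}}\le\pi_{\boldsymbol{\lambda}}(\mathcal{G}_1,\ldots,\mathcal{G}_k)\le\lambda_*.$$ In particular, $\overline{\mathrm{M}}_{\boldsymbol{\lambda}}(n;\mathcal{G}_1,\ldots,\mathcal{G}_k)=\Theta(n^{h_*})$ as $n\to\infty$.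
   Context: An ordered graph is a pair $\mathcal{G}=(G,<_{\mathcal{G}})$ where $G$ is a finite graph and $<_{\mathcal{G}}$ is a linear order on $V(G)$; $v(\mathcal{G})$ is its number of vertices. $[k]=\{1,\ldots,k\}$. $\mathcal{K}_n$ is the complete graph on $[n]$ with the natural order. An order-preserving copy of an ordered graph $\mathcal{H}$ in $\mathcal{G}$ is an injective map $V(\mathcal{H})\to V(\mathcal{G})$ that preserves the vertex order and maps every edge of $\mathcal{H}$ to an edge of $\mathcal{G}$; copies are counted by their vertex sets (an $h$-element vertex set supports at most one copy of a fixed $h$-vertex ordered graph). For a coloring $\chi:E(\mathcal{K}_n)\to[k]$, $N_i(\chi;\mathcal{G}_i)$ is the number of order-preserving copies of $\mathcal{G}_i$ in $\mathcal{K}_n$ all of whose edges have color $i$. The ordered Ramsey number $\overline{\mathrm{R}}(\mathcal{G}_1,\ldots,\mathcal{G}_k)$ is the least $N$ such that every $k$-edge-coloring of $\mathcal{K}_N$ contains an order-preserving copy of $\mathcal{G}_i$ in color $i$ for some $i\in[k]$. The weighted ordered multiplicity function is $$\overline{\mathrm{M}}_{\boldsymbol{\lambda}}(n;\mathcal{G}_1,\ldots,\mathcal{G}_k)=\min_{\chi:E(\mathcal{K}_n)\to[k]}\sum_{i=1}^{k}\lambda_iN_i(\chi;\mathcal{G}_i),$$ and the weighted threshold multiplicity is $\overline{\mathrm{RM}}_{\boldsymbol{\lambda}}(\mathcal{G}_1,\ldots,\mathcal{G}_k)=\overline{\mathrm{M}}_{\boldsymbol{\lambda}}(R;\mathcal{G}_1,\ldots,\mathcal{G}_k)$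 with $R=\overline{\mathrm{R}}(\mathcal{G}_1,\ldots,\mathcal{G}_k)$. -}

module Defs where

open import Level using (0ℓ; _⊔_) renaming (suc to lsuc)
open import Data.Nat.Base as ℕ using (ℕ; zero; suc; NonZero; s≤s; z≤n)
import Data.Nat.Properties as ℕₚ
open import Data.Fin.Base as Fin using (Fin; zero; suc; _<_; fromℕ<; finToFun; funToFin; combine; remQuot)
import Data.Fin.Properties as Finₚ
open import Data.Fin.Subset using (Subset; inside; outside; _∈_; ∣_∣)
import Data.Fin.Subset.Properties as Subsetₚ
open import Data.Vec.Base as Vec using (_∷_; [])
import Data.Vec.Properties as Vecₚ
open import Data.Vec.Functional using (updateAt)
import Data.Vec.Functional.Properties as VFₚ
open import Data.List.Base as List using (List; _∷_; []; _++_; filter; length)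
import Data.List.Properties as Listₚ
open import Data.List.Membership.Propositional using () renaming (_∈_ to _∈ˡ_)
open import Data.List.Membership.Propositional.Properties using (∈-lookup; ∈-filter⁻)
open import Data.List.Relation.Binary.Subset.Propositional using () renaming (_⊆_ to _⊆ˡ_)
open import Data.List.Relation.Unary.All as All using (All; _∷_; [])
import Data.List.Relation.Unary.All.Properties as Allₚ
open import Data.List.Relation.Unary.Any using (here; there)
open import Data.List.Relation.Unary.AllPairs using (AllPairs; _∷_; [])
import Data.List.Relation.Unary.AllPairs.Properties as AllPairsₚ
open import Data.Product.Base using (Σ; Σ-syntax; ∃; ∃-syntax; _×_; _,_; proj₁; proj₂)
open import Data.Sum.Base using (inj₁; inj₂)
open import Function.Base using (_∘_)
open import Function.Bundles using (_↔_; _⇔_; Inverse; Equivalence; mk⇔)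
open import Function.Definitions using (Injective)
open import Relation.Binary.Core using (Rel)
open import Relation.Binary.Bundles using (TotalOrder)
open import Relation.Binary.Definitions using (Decidable; Symmetric; Irreflexive; tri<; tri≈; tri>)
open import Relation.Binary.Structures using (IsStrictTotalOrder; IsDecTotalOrder)
open import Relation.Binary.PropositionalEquality using (_≡_; _≗_; refl; sym; trans; cong; subst; subst₂)
open import Relation.Nullary using (Dec; yes; no; does; ¬_; contradiction)
open import Relation.Nullary.Decidable using (map′; dec-true; _×-dec_; _→-dec_)
open import Relation.Unary using (Pred)
open import Algebra.Core using (Op₁; Op₂)
open import Algebra.Structures using (IsCommutativeRing)
open import Algebra.Bundles using (CommutativeRing)
import Algebra.Definitions.RawMonoid as MonoidOps

------------------------------------------------------------------------
-- The real numbers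
------------------------------------------------------------------------

-- ℝ enters as an arbitrary Dedekind-complete ordered field, which
-- determines it up to isomorphism.  The axioms are the classical ones: the
-- order is decidable, and `sup` applies to every inhabited bounded
-- predicate; its second clause is the positive form of "no number below s
-- is an upper bound".  The inverse is total, with 0# ⁻¹ left unspecified.

record CompleteOrderedField c ℓ₁ ℓ₂ : Set (lsuc (c ⊔ ℓ₁ ⊔ ℓ₂)) where
  infix  8 _⁻¹
  infixl 7 _*_ _/_
  infixl 6 _+_ _-_
  infix  4 _≈_ _≤_ _<ᵣ_
  field
    Carrier           : Set c
    _≈_               : Rel Carrier ℓ₁
    _≤_               : Rel Carrier ℓ₂
    _+_ _*_           : Op₂ Carrier
    -_ _⁻¹            : Op₁ Carrier
    0# 1#             : Carrier
    isCommutativeRing : IsCommutativeRing _≈_ _+_ _*_ -_ 0# 1#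
    isDecTotalOrder   : IsDecTotalOrder _≈_ _≤_
    0≉1               : ¬ 0# ≈ 1#
    ⁻¹-inverse        : ∀ x → ¬ x ≈ 0# → x * x ⁻¹ ≈ 1#
    +-monoˡ-≤         : ∀ {x y} z → x ≤ y → x + z ≤ y + z
    *-nonneg          : ∀ {x y} → 0# ≤ x → 0# ≤ y → 0# ≤ x * y

  _<ᵣ_ : Rel Carrier (ℓ₁ ⊔ ℓ₂)
  x <ᵣ y = x ≤ y × ¬ x ≈ y

  field
    sup : (P : Pred Carrier (c ⊔ ℓ₁ ⊔ ℓ₂)) → ∃ P →
          ∃[ b ] (∀ x → P x → x ≤ b) →
          ∃[ s ] (∀ x → P x → x ≤ s) × (∀ y → y <ᵣ s → ∃[ x ] P x × y <ᵣ x)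

  commutativeRing : CommutativeRing c ℓ₁
  commutativeRing = record { isCommutativeRing = isCommutativeRing }

  totalOrder : TotalOrder c ℓ₁ ℓ₂
  totalOrder = record { isTotalOrder = IsDecTotalOrder.isTotalOrder isDecTotalOrder }

  _-_ _/_ : Op₂ Carrier
  x - y = x + (- y)
  x / y = x * y ⁻¹

  private
    module +-Monoid = MonoidOps (CommutativeRing.+-rawMonoid commutativeRing)

  fromℕ : ℕ → Carrier
  fromℕ n = n +-Monoid.× 1#

  ∑ : ∀ {n} → (Fin n → Carrier) → Carrier
  ∑ = +-Monoid.sum

  _⟶_ : (ℕ → Carrier) → Carrier → Set (c ⊔ ℓ₁ ⊔ ℓ₂)
  a ⟶ L = ∀ ε → 0# <ᵣ ε → ∃[ n₀ ] ∀ n → n₀ ℕ.≤ n →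
          (L - ε <ᵣ a n) × (a n <ᵣ L + ε)

  _=Θ_ : (ℕ → Carrier) → (ℕ → Carrier) → Set (c ⊔ ℓ₁ ⊔ ℓ₂)
  f =Θ g = ∃[ A ] ∃[ B ] ∃[ n₀ ] (0# <ᵣ A) × (0# <ᵣ B) ×
           (∀ n → n₀ ℕ.≤ n → (A * g n ≤ f n) × (f n ≤ B * g n))

------------------------------------------------------------------------
-- Minima of functions on finite types
------------------------------------------------------------------------

module _ {c ℓ₁ ℓ₂} (O : TotalOrder c ℓ₁ ℓ₂) where
  open TotalOrder O renaming (refl to ≤-refl; trans to ≤-trans) using (Carrier; _≈_; _≤_; total; reflexive; module Eq)

  IsMinimumOf : ∀ {i} {I : Set i} → (I → Carrier) → Carrier → Set _
  IsMinimumOf f m = (∃[ x ] f x ≈ m) × (∀ x → m ≤ f x)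

  argmin : ∀ {m} (g : Fin (suc m) → Carrier) → ∃[ a ] ∀ b → g a ≤ g b
  argmin {zero}  g = zero , λ where zero → ≤-refl
  argmin {suc m} g with a , low ← argmin (g ∘ suc) with total (g zero) (g (suc a))
  ... | inj₁ le = zero  , λ where zero    → ≤-refl
                                  (suc b) → ≤-trans le (low b)
  ... | inj₂ ge = suc a , λ where zero    → ge
                                  (suc b) → low b

  -- The second hypothesis says that every value of f is attained on the
  -- range of e.
  minimum : ∀ {i} {I : Set i} {m} (f : I → Carrier) (e : Fin m → I) →
            (∀ x → ∃[ a ] f (e a) ≈ f x) → I → ∃ (IsMinimumOf f)
  minimum {m = zero}  f e cover x₀ with () ← proj₁ (cover x₀)
  minimum {m = suc m} f e cover x₀ with a , low ← argmin (f ∘ e) =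
    f (e a) , (e a , Eq.refl) ,
    λ x → let b , eq = cover x in ≤-trans (low b) (reflexive eq)

IsLeast : ∀ {p} → Pred ℕ p → ℕ → Set p
IsLeast P n = P n × (∀ m → P m → n ℕ.≤ m)

least : ∀ {p} {P : Pred ℕ p} → (∀ n → Dec (P n)) → ∀ n → P n → ∃ (IsLeast P)
least P? zero    pn = zero , pn , λ _ _ → z≤n
least P? (suc n) pn with P? zero
... | yes p0 = zero , p0 , λ _ _ → z≤n
... | no ¬p0 with m , pm , low ← least (P? ∘ suc) n pn =
  suc m , pm , λ where zero    p0 → contradiction p0 ¬p0
                       (suc j) pj → s≤s (low j pj)

------------------------------------------------------------------------
-- Ordered graphs, colorings and monochromatic copies
------------------------------------------------------------------------

record OrderedGraph : Set₁ where
  infix 4 _≺_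
  field
    V                  : Set
    v                  : ℕ
    vertices           : V ↔ Fin v
    _≺_                : Rel V 0ℓ
    isStrictTotalOrder : IsStrictTotalOrder _≡_ _≺_
    Adj                : Rel V 0ℓ
    Adj-sym            : Symmetric Adj
    Adj-irrefl         : Irreflexive _≡_ Adj
    _Adj?_             : Decidable Adj

  open IsStrictTotalOrder isStrictTotalOrder public using (compare; _<?_; irrefl)

HasEdge : OrderedGraph → Set
HasEdge H = ∃[ x ] ∃[ y ] Adj x y
  where open OrderedGraph H

-- Colorings of E(𝒦ₙ) with color set Fin k: the vertex set is Fin n, and an
-- edge {i , j} is given by its endpoints in increasing order.

Coloring : ℕ → ℕ → Set
Coloring k n = (i j : Fin n) → i < j → Fin k

-- `color` ranges over both orientations of an edge of H, so by Adj-sym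
-- every edge is constrained.  Since 𝒦ₙ is complete, edges are mapped to
-- edges automatically.

record MonoCopy (H : OrderedGraph) {k n} (χ : Coloring k n) (c : Fin k) : Set where
  open OrderedGraph H
  field
    map       : V → Fin n
    injective : Injective _≡_ _≡_ map
    monotone  : ∀ {x y} → x ≺ y → map x < map y
    color     : ∀ {x y} → Adj x y → (p : map x < map y) → χ (map x) (map y) p ≡ c

SupportsCopy : ∀ (H : OrderedGraph) {k n} → Coloring k n → Fin k → Subset n → Set
SupportsCopy H χ c S =
  Σ[ f ∈ MonoCopy H χ c ] ∀ a → a ∈ S ⇔ (∃[ x ] MonoCopy.map f x ≡ a)

module _ (H : OrderedGraph) {k n : ℕ} where
  open OrderedGraph H
  open Inverse vertices using (to; from; strictlyInverseʳ)

  all-V? : ∀ {p} {P : Pred V p} → (∀ x → Dec (P x)) → Dec (∀ x → P x)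
  all-V? {P = P} P? = map′ (λ h x → subst P (strictlyInverseʳ x) (h (to x)))
                           (λ h i → h (from i)) (Finₚ.all? (P? ∘ from))

  any-V? : ∀ {p} {P : Pred V p} → (∀ x → Dec (P x)) → Dec (∃ P)
  any-V? {P = P} P? = map′ (λ (i , p) → from i , p)
                           (λ (x , p) → to x , subst P (sym (strictlyInverseʳ x)) p)
                           (Finₚ.any? (P? ∘ from))

  monotone⇒injective : (f : V → Fin n) → (∀ {x y} → x ≺ y → f x < f y) → Injective _≡_ _≡_ f
  monotone⇒injective f mono {x} {y} eq with compare x y
  ... | tri< lt _ _ = contradiction (mono lt) (Finₚ.<-irrefl eq)
  ... | tri≈ _ x≡y _ = x≡y
  ... | tri> _ _ gt = contradiction (mono gt) (Finₚ.<-irrefl (sym eq))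

  any-map? : {P : Pred (V → Fin n) 0ℓ} → (∀ {f g} → f ≗ g → P f → P g) →
             (∀ f → Dec (P f)) → Dec (∃ P)
  any-map? {P} resp P? = map′ (λ (a , p) → finToFun a ∘ to , p) there′
                              (Finₚ.any? (λ a → P? (finToFun {n} {v} a ∘ to)))
    where
    there′ : ∃ P → ∃[ a ] P (finToFun a ∘ to)
    there′ (f , p) = funToFin (f ∘ from) , resp
      (λ x → sym (trans (Finₚ.finToFun-funToFin (f ∘ from) (to x))
                        (cong f (strictlyInverseʳ x)))) p

  module _ (χ : Coloring k n) (c : Fin k) where

    IsMonoCopy : (V → Fin n) → Set
    IsMonoCopy f = ∀ x y → (x ≺ y → f x < f y) ×
                           (Adj x y → (p : f x < f y) → χ (f x) (f y) p ≡ c)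

    IsMonoCopy-resp : ∀ {f g} → f ≗ g → IsMonoCopy f → IsMonoCopy g
    IsMonoCopy-resp {f} {g} f≗g h x y with h x y
    ... | h₁ , h₂ rewrite f≗g x | f≗g y = h₁ , h₂

    isMonoCopy? : ∀ f → Dec (IsMonoCopy f)
    isMonoCopy? f = all-V? λ x → all-V? λ y →
      ((x <? y) →-dec (f x Finₚ.<? f y)) ×-dec ((x Adj? y) →-dec edge? x y)
      where
      edge? : ∀ x y → Dec ((p : f x < f y) → χ (f x) (f y) p ≡ c)
      edge? x y with f x Finₚ.<? f y
      ... | no ¬p = yes (λ p → contradiction p ¬p)
      ... | yes p = map′ (λ eq q → trans (cong (χ _ _) (Finₚ.<-irrelevant q p)) eq)
                         (λ h → h p) (χ _ _ p Finₚ.≟ c)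

    toMonoCopy : ∀ f → IsMonoCopy f → MonoCopy H χ c
    toMonoCopy f h = record
      { map       = f
      ; injective = monotone⇒injective f (λ {x} {y} → proj₁ (h x y))
      ; monotone  = λ {x} {y} → proj₁ (h x y)
      ; color     = λ {x} {y} → proj₂ (h x y)
      }

    fromMonoCopy : (m : MonoCopy H χ c) → IsMonoCopy (MonoCopy.map m)
    fromMonoCopy m x y = MonoCopy.monotone m , MonoCopy.color m

    monoCopy? : Dec (MonoCopy H χ c)
    monoCopy? = map′ (λ (f , h) → toMonoCopy f h) (λ m → MonoCopy.map m , fromMonoCopy m)
                     (any-map? IsMonoCopy-resp isMonoCopy?)

    supportsCopy? : ∀ S → Dec (SupportsCopy H χ c S)
    supportsCopy? S = map′ (λ (f , h , im) → toMonoCopy f h , im)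
                           (λ (m , im) → MonoCopy.map m , fromMonoCopy m , im)
                           (any-map? resp λ f → isMonoCopy? f ×-dec image? f)
      where
      IsImage : (V → Fin n) → Set
      IsImage f = ∀ a → a ∈ S ⇔ (∃[ x ] f x ≡ a)

      image? : ∀ f → Dec (IsImage f)
      image? f = Finₚ.all? λ a → map′ (λ (g , h) → mk⇔ g h)
        (λ e → Equivalence.to e , Equivalence.from e)
        ((a Subsetₚ.∈? S →-dec any-V? λ x → f x Finₚ.≟ a) ×-dec
         ((any-V? λ x → f x Finₚ.≟ a) →-dec a Subsetₚ.∈? S))

      resp : ∀ {f g} → f ≗ g → IsMonoCopy f × IsImage f → IsMonoCopy g × IsImage g
      resp {f} {g} f≗g (h , im) = IsMonoCopy-resp f≗g h , λ a → mk⇔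
        (λ a∈S → let x , eq = Equivalence.to (im a) a∈S in x , trans (sym (f≗g x)) eq)
        (λ (x , eq) → Equivalence.from (im a) (x , trans (f≗g x) eq))

subsets : ∀ n → List (Subset n)
subsets zero    = [] ∷ []
subsets (suc n) = List.map (inside ∷_) (subsets n) ++ List.map (outside ∷_) (subsets n)

copies : ∀ (H : OrderedGraph) {k n} → Coloring k n → Fin k → ℕ
copies H {n = n} χ c = length (filter (supportsCopy? H χ c) (subsets n))

-- Invariance under pointwise equality of colorings.

_≗ᶜ_ : ∀ {k n} → Coloring k n → Coloring k n → Set
χ ≗ᶜ χ′ = ∀ i j p → χ i j p ≡ χ′ i j p

≗ᶜ-sym : ∀ {k n} {χ χ′ : Coloring k n} → χ ≗ᶜ χ′ → χ′ ≗ᶜ χ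
≗ᶜ-sym eq i j p = sym (eq i j p)

MonoCopy-cong : ∀ H {k n} {χ χ′ : Coloring k n} {c} → χ ≗ᶜ χ′ →
                MonoCopy H χ c → MonoCopy H χ′ c
MonoCopy-cong H eq m = record
  { map = map ; injective = injective ; monotone = monotone
  ; color = λ adj p → trans (sym (eq _ _ p)) (color adj p) }
  where open MonoCopy m

copies-cong : ∀ H {k n} {χ χ′ : Coloring k n} c → χ ≗ᶜ χ′ → copies H χ c ≡ copies H χ′ c
copies-cong H {n = n} {χ} {χ′} c eq = cong length (Listₚ.filter-≐
  (supportsCopy? H χ c) (supportsCopy? H χ′ c)
  ((λ (m , im) → MonoCopy-cong H eq m , im) ,
   (λ (m , im) → MonoCopy-cong H (≗ᶜ-sym eq) m , im)) (subsets n))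

someColor : ∀ k .{{_ : NonZero k}} → Fin k
someColor k = fromℕ< {0} (ℕ.>-nonZero⁻¹ k)

decodeColoring : ∀ {k n} → Fin (k ℕ.^ (n ℕ.* n)) → Coloring k n
decodeColoring a i j _ = finToFun a (combine i j)

decodeColoring-surjective : ∀ {k n} .{{_ : NonZero k}} (χ : Coloring k n) →
                            ∃[ a ] decodeColoring a ≗ᶜ χ
decodeColoring-surjective {k} {n} χ = funToFin table , λ i j p →
  trans (Finₚ.finToFun-funToFin table (combine i j))
        (trans (cong (λ (i , j) → extend i j) (Finₚ.remQuot-combine i j)) (extend-< i j p))
  where
  extend : Fin n → Fin n → Fin k
  extend i j with i Finₚ.<? j
  ... | yes p = χ i j p
  ... | no  _ = someColor k

  extend-< : ∀ i j p → extend i j ≡ χ i j p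
  extend-< i j p with i Finₚ.<? j
  ... | yes q = cong (χ i j) (Finₚ.<-irrelevant q p)
  ... | no ¬p = contradiction p ¬p

  table : Fin (n ℕ.* n) → Fin k
  table = (λ (i , j) → extend i j) ∘ remQuot n

------------------------------------------------------------------------
-- The ordered Ramsey number
------------------------------------------------------------------------

module _ {k : ℕ} .{{_ : NonZero k}} where

  Arrows : (Fin k → OrderedGraph) → ℕ → Set
  Arrows G N = ∀ (χ : Coloring k N) → ∃[ i ] MonoCopy (G i) χ i

  arrows? : ∀ G N → Dec (Arrows G N)
  arrows? G N = map′ {A = ∀ a → ∃[ i ] MonoCopy (G i) (decodeColoring a) i}
    (λ h χ → let a , eq = decodeColoring-surjective χ ; i , m = h a
             in i , MonoCopy-cong (G i) eq m)
    (λ h a → h (decodeColoring a))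
    (Finₚ.all? λ a → Finₚ.any? λ i → monoCopy? (G i) (decodeColoring a) i)

-- Finiteness of the ordered Ramsey number: in any coloring, a long enough
-- increasing list of vertices contains, for some i, a clique of color i on
-- any prescribed number h i of vertices.

∑ℕ : ∀ {k} → (Fin k → ℕ) → ℕ
∑ℕ = MonoidOps.sum ℕ.+-0-rawMonoid

decrement : ∀ {k} → (Fin k → ℕ) → Fin k → (Fin k → ℕ)
decrement h i = updateAt h i ℕ.pred

suc∘decrement : ∀ {k} (h : Fin k → ℕ) i → ¬ h i ≡ 0 → suc (decrement h i i) ≡ h i
suc∘decrement h i hi≢0 = trans (cong suc (VFₚ.updateAt-updates i h))
                               (ℕₚ.suc-pred (h i) {{ℕ.≢-nonZero hi≢0}})

∑-decrement : ∀ {k} (h : Fin k → ℕ) i → ¬ h i ≡ 0 → suc (∑ℕ (decrement h i)) ≡ ∑ℕ h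
∑-decrement h zero    hi≢0 = cong (ℕ._+ ∑ℕ (h ∘ suc)) (ℕₚ.suc-pred (h zero) {{ℕ.≢-nonZero hi≢0}})
∑-decrement h (suc i) hi≢0 = trans (sym (ℕₚ.+-suc (h zero) _))
                                   (cong (h zero ℕ.+_) (∑-decrement (h ∘ suc) i hi≢0))

component≤∑ : ∀ {k} (h : Fin k → ℕ) i → h i ℕ.≤ ∑ℕ h
component≤∑ h zero    = ℕₚ.m≤m+n _ _
component≤∑ h (suc i) = ℕₚ.≤-trans (component≤∑ (h ∘ suc) i) (ℕₚ.m≤n+m _ _)

module _ {k n : ℕ} (χ : Coloring k n) where

  Joined : Fin k → Rel (Fin n) 0ℓ
  Joined c x y = Σ[ p ∈ x < y ] χ x y p ≡ c

  joined? : ∀ c x y → Dec (Joined c x y)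
  joined? c x y with x Finₚ.<? y
  ... | no ¬p = no (¬p ∘ proj₁)
  ... | yes p = map′ (p ,_) (λ (q , eq) → trans (cong (χ x y) (Finₚ.<-irrelevant p q)) eq)
                     (χ x y p Finₚ.≟ c)

  neighbours : Fin k → Fin n → List (Fin n) → List (Fin n)
  neighbours c x = filter (joined? c x)

  largeClass : .{{_ : NonZero k}} → ∀ (N : Fin k → ℕ) x ys → All (x <_) ys →
               ∑ℕ N ℕ.≤ length ys → ∃[ i ] N i ℕ.≤ length (neighbours i x ys)
  largeClass N x []       _          le = someColor k , ℕₚ.≤-trans (component≤∑ N _) le
  largeClass N x (y ∷ ys) (p ∷ x<ys) le with N (χ x y p) ℕₚ.≟ 0
  ... | yes Nc≡0 = χ x y p , ℕₚ.≤-trans (ℕₚ.≤-reflexive Nc≡0) z≤n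
  ... | no  Nc≢0 with largeClass (decrement N (χ x y p)) x ys x<ys
                        (ℕ.s≤s⁻¹ (ℕₚ.≤-trans (ℕₚ.≤-reflexive (∑-decrement N _ Nc≢0)) le))
  ...   | i , le′ with i Finₚ.≟ χ x y p
  ...     | yes refl = χ x y p , subst₂ ℕ._≤_ (suc∘decrement N (χ x y p) Nc≢0)
    (cong length (sym (Listₚ.filter-accept (joined? (χ x y p) x) {xs = ys} (p , refl)))) (s≤s le′)
  ...     | no i≢c = i , subst₂ ℕ._≤_ (VFₚ.updateAt-minimal i (χ x y p) N i≢c)
    (cong length (sym (Listₚ.filter-reject (joined? i x) {x = y} {xs = ys}
      (λ (q , eq) → i≢c (trans (sym eq) (cong (χ x y) (Finₚ.<-irrelevant q p))))))) le′

  CliqueIn : List (Fin n) → (Fin k → ℕ) → Fin k → Set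
  CliqueIn xs h i = ∃[ ys ] ys ⊆ˡ xs × length ys ≡ h i × AllPairs (Joined i) ys

cliqueNumber : ∀ {k} .{{_ : NonZero k}} m (h : Fin k → ℕ) → ∑ℕ h ℕ.≤ m →
  ∃[ N ] ∀ {n} (χ : Coloring k n) xs → AllPairs _<_ xs → N ℕ.≤ length xs → ∃ (CliqueIn χ xs h)
cliqueNumber m h le with Finₚ.any? (λ i → h i ℕₚ.≟ 0)
... | yes (i , hi≡0) = 0 , λ χ xs _ _ → i , [] , (λ ()) , sym hi≡0 , []
cliqueNumber {k} zero    h le | no ¬0 =
  contradiction (someColor k , ℕₚ.n≤0⇒n≡0 (ℕₚ.≤-trans (component≤∑ h _) le)) ¬0
cliqueNumber {k} (suc m) h le | no ¬0 = suc (∑ℕ (proj₁ ∘ smaller)) , extend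
  where
  h≢0 : ∀ i → ¬ h i ≡ 0
  h≢0 i eq = ¬0 (i , eq)

  smaller : ∀ i → ∃[ N ] ∀ {n} (χ : Coloring k n) xs → AllPairs _<_ xs → N ℕ.≤ length xs →
            ∃ (CliqueIn χ xs (decrement h i))
  smaller i = cliqueNumber m (decrement h i)
    (ℕ.s≤s⁻¹ (ℕₚ.≤-trans (ℕₚ.≤-reflexive (∑-decrement h i (h≢0 i))) le))

  extend : ∀ {n} (χ : Coloring k n) xs → AllPairs _<_ xs →
           suc (∑ℕ (proj₁ ∘ smaller)) ℕ.≤ length xs → ∃ (CliqueIn χ xs h)
  extend χ (x ∷ xs) (x<xs ∷ xs↑) (s≤s le)
    with i , le′ ← largeClass χ (proj₁ ∘ smaller) x xs x<xs le
    with j , ys , ys⊆ , len , clique ← proj₂ (smaller i) χ (neighbours χ i x xs)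
                                         (AllPairsₚ.filter⁺ (joined? χ i x) xs↑) le′
    with j Finₚ.≟ i
  ... | yes refl = i , x ∷ ys , sub , trans (cong suc len) (suc∘decrement h i (h≢0 i)) ,
                   All.tabulate (λ y∈ → proj₂ (∈-filter⁻ (joined? χ i x) {xs = xs} (ys⊆ y∈))) ∷ clique
    where
    sub : x ∷ ys ⊆ˡ x ∷ xs
    sub (here eq)  = here eq
    sub (there y∈) = there (proj₁ (∈-filter⁻ (joined? χ i x) (ys⊆ y∈)))
  ... | no j≢i = j , ys , (λ y∈ → there (proj₁ (∈-filter⁻ (joined? χ i x) (ys⊆ y∈)))) ,
                 trans len (VFₚ.updateAt-minimal j i h j≢i) , clique

module _ (H : OrderedGraph) where
  open OrderedGraph H
  open Inverse vertices using (to; from; strictlyInverseʳ)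
  open IsStrictTotalOrder isStrictTotalOrder using () renaming (trans to ≺-trans)

  below : V → Subset v
  below x = Vec.tabulate (λ i → does (from i <? x))

  ∈-below⁺ : ∀ {x i} → from i ≺ x → i ∈ below x
  ∈-below⁺ {x} {i} lt = Vecₚ.lookup⇒[]= i (below x)
    (trans (Vecₚ.lookup∘tabulate _ i) (dec-true (from i <? x) lt))

  ∈-below⁻ : ∀ {x i} → i ∈ below x → from i ≺ x
  ∈-below⁻ {x} {i} i∈ with from i <? x | trans (sym (Vecₚ.lookup∘tabulate _ i)) (Vecₚ.[]=⇒lookup i∈)
  ... | yes lt | _ = lt
  ... | no  _  | ()

  self∉below : ∀ x → ¬ to x ∈ below x
  self∉below x x∈ = irrefl (strictlyInverseʳ x) (∈-below⁻ x∈)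

  rank< : ∀ x → ∣ below x ∣ ℕ.< v
  rank< x = subst (∣ below x ∣ ℕ.<_) (Subsetₚ.∣⊤∣≡n v)
    (Subsetₚ.p⊂q⇒∣p∣<∣q∣ (Subsetₚ.⊆⊤ , to x , Subsetₚ.∈⊤ , self∉below x))

  rank-mono : ∀ {x y} → x ≺ y → ∣ below x ∣ ℕ.< ∣ below y ∣
  rank-mono {x} {y} x≺y = Subsetₚ.p⊂q⇒∣p∣<∣q∣
    ( (λ i∈ → ∈-below⁺ (≺-trans (∈-below⁻ i∈) x≺y))
    , to x , ∈-below⁺ (subst (_≺ y) (sym (strictlyInverseʳ x)) x≺y) , self∉below x)

lookup-AllPairs : ∀ {A : Set} {R : Rel A 0ℓ} {xs} → AllPairs R xs →
                  ∀ {i j} → i < j → R (List.lookup xs i) (List.lookup xs j)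
lookup-AllPairs (px ∷ _)   {zero}  {suc j} _        = All.lookup px (∈-lookup j)
lookup-AllPairs (_  ∷ pxs) {suc i} {suc j} (s≤s lt) = lookup-AllPairs pxs lt

clique⇒MonoCopy : ∀ (H : OrderedGraph) {k n} (χ : Coloring k n) c ys →
                  length ys ≡ OrderedGraph.v H → AllPairs (Joined χ c) ys → MonoCopy H χ c
clique⇒MonoCopy H {n = n} χ c ys len clique = record
  { map       = f
  ; injective = monotone⇒injective H {k = 0} f (proj₁ ∘ joined)
  ; monotone  = proj₁ ∘ joined
  ; color     = color
  }
  where
  open OrderedGraph H

  position : V → Fin (length ys)
  position x = fromℕ< (subst (∣ below H x ∣ ℕ.<_) (sym len) (rank< H x))

  f : V → Fin n
  f = List.lookup ys ∘ position

  joined : ∀ {x y} → x ≺ y → Joined χ c (f x) (f y)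
  joined lt = lookup-AllPairs clique
    (subst₂ ℕ._<_ (sym (Finₚ.toℕ-fromℕ< _)) (sym (Finₚ.toℕ-fromℕ< _)) (rank-mono H lt))

  color : ∀ {x y} → Adj x y → (p : f x < f y) → χ (f x) (f y) p ≡ c
  color {x} {y} adj p with compare x y
  ... | tri< lt _ _ = let q , eq = joined lt in trans (cong (χ _ _) (Finₚ.<-irrelevant p q)) eq
  ... | tri≈ _ eq _ = contradiction adj (Adj-irrefl eq)
  ... | tri> _ _ gt = contradiction (proj₁ (joined gt)) (Finₚ.<-asym p)

module _ {k : ℕ} .{{_ : NonZero k}} (G : Fin k → OrderedGraph) where

  finiteRamsey : ∃ (Arrows G)
  finiteRamsey with N , clique ← cliqueNumber _ (OrderedGraph.v ∘ G) ℕₚ.≤-refl = N , λ χ →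
    let i , ys , _ , len , joined = clique χ (List.allFin N)
          (AllPairsₚ.tabulate⁺-< (λ p → p)) (ℕₚ.≤-reflexive (sym (Listₚ.length-tabulate _)))
    in i , clique⇒MonoCopy (G i) χ i ys len joined

  abstract
    orderedRamsey : ∃ (IsLeast (Arrows G))
    orderedRamsey = least (arrows? G) (proj₁ finiteRamsey) (proj₂ finiteRamsey)

  R̄ : ℕ
  R̄ = proj₁ orderedRamsey

------------------------------------------------------------------------
-- Weighted multiplicities
------------------------------------------------------------------------

  abstract
    smallestSize : ∃ (IsMinimumOf ℕₚ.≤-totalOrder (OrderedGraph.v ∘ G))
    smallestSize = minimum ℕₚ.≤-totalOrder _ (λ i → i) (λ i → i , refl) (someColor k)

  h⋆ : ℕ
  h⋆ = proj₁ smallestSize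

  I⋆ : Set
  I⋆ = Σ[ i ∈ Fin k ] OrderedGraph.v (G i) ≡ h⋆

  module Multiplicity {c ℓ₁ ℓ₂} (ℝ : CompleteOrderedField c ℓ₁ ℓ₂)
                      (λs : Fin k → CompleteOrderedField.Carrier ℝ) where
    open CompleteOrderedField ℝ
    open CommutativeRing commutativeRing using (+-cong; *-cong) renaming (refl to ≈-refl; reflexive to ≈-reflexive)

    weightedCopies : ∀ {n} → Coloring k n → Carrier
    weightedCopies χ = ∑ λ i → λs i * fromℕ (copies (G i) χ i)

    abstract
      multiplicity : ∀ n → ∃ (IsMinimumOf totalOrder (weightedCopies {n}))
      multiplicity n = minimum totalOrder weightedCopies decodeColoring
        (λ χ → let a , eq = decodeColoring-surjective χ in a , weightedCopies-cong eq)
        (λ _ _ _ → someColor k)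
        where
        ∑-cong : ∀ {m} {f g : Fin m → Carrier} → (∀ i → f i ≈ g i) → ∑ f ≈ ∑ g
        ∑-cong {zero}  eq = ≈-refl
        ∑-cong {suc m} eq = +-cong (eq zero) (∑-cong (eq ∘ suc))

        weightedCopies-cong : {χ χ′ : Coloring k n} → χ ≗ᶜ χ′ → weightedCopies χ ≈ weightedCopies χ′
        weightedCopies-cong eq = ∑-cong λ i →
          *-cong ≈-refl (≈-reflexive (cong fromℕ (copies-cong (G i) i eq)))

      smallestWeight : ∃ (IsMinimumOf totalOrder {I = I⋆} (λs ∘ proj₁))
      smallestWeight = minimum totalOrder (λs ∘ proj₁) restrict cover i⋆
        where
        i⋆ : I⋆
        i⋆ = proj₁ (proj₂ smallestSize)

        restrict : Fin k → I⋆
        restrict i with OrderedGraph.v (G i) ℕₚ.≟ h⋆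
        ... | yes eq = i , eq
        ... | no  _  = i⋆

        cover : ∀ (j : I⋆) → ∃[ i ] λs (proj₁ (restrict i)) ≈ λs (proj₁ j)
        cover (j , eq) = j , go
          where
          go : λs (proj₁ (restrict j)) ≈ λs j
          go with OrderedGraph.v (G j) ℕₚ.≟ h⋆
          ... | yes _  = ≈-refl
          ... | no ¬eq = contradiction eq ¬eq

    M̄ : ℕ → Carrier
    M̄ n = proj₁ (multiplicity n)

    RM̄ : Carrier
    RM̄ = M̄ R̄

    λ⋆ : Carrier
    λ⋆ = proj₁ smallestWeight

{-# OPTIONS --safe #-}
module Submission where

-- Deleting one vertex x from a coloring χ of 𝒦ₙ₊₁ keeps exactly the copies of
-- G i that avoid x, so over all x each copy is counted n + 1 − v (G i) ≤ n + 1 − h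
-- times.  For an optimal χ this gives (n + 1) M̄ n ≤ (n + 1 − h) M̄ (n + 1), and
-- since (n + 1) (n C h) = (n + 1 − h) (n + 1 C h), the density M̄ n / (n C h) does
-- not decrease.  It is at most λ⋆: color all edges with a j ∈ I⋆ of weight λ⋆; every
-- other G i has an edge, hence no copy.  The limit is the supremum, and it is
-- positive because every coloring of 𝒦_R contains a copy.

open import Level using (Level; Lift; lift; _⊔_)
open import Data.Bool.Base using (Bool; true; false; if_then_else_)
open import Data.Nat.Base as ℕ using (ℕ; zero; suc; NonZero; s≤s; z≤n; _∸_; _!)
import Data.Nat.Properties as ℕₚ
open import Data.Nat.Combinatorics using (_C_; nCk+nC[k+1]≡[n+1]C[k+1]; nC1≡n)
open import Data.Nat.Solver using (module +-*-Solver)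
open import Data.Fin.Base using (Fin; zero; suc; _<_; punchIn; punchOut)
import Data.Fin.Properties as Finₚ
open import Data.Fin.Subset using (Subset; inside; outside; _∈_; _∉_; ∣_∣; ∁)
open import Data.Fin.Subset.Properties using (_∈?_; ∣∁p∣≡n∸∣p∣)
open import Data.Vec.Base as Vec using (_∷_; []; insertAt; here; there)
import Data.Vec.Properties as Vecₚ
open import Data.List.Base as List using (List; _∷_; []; _++_; filter; length)
import Data.List.Properties as Listₚ
open import Data.List.Membership.Propositional using () renaming (_∈_ to _∈ˡ_)
open import Data.List.Membership.Propositional.Properties using (∈-filter⁺; ∈-length; ∈-++⁺ˡ; ∈-++⁺ʳ; ∈-map⁺)
import Data.List.Relation.Unary.Any as Any
open import Data.Product.Base using (∃; ∃-syntax; _×_; _,_; proj₁; proj₂)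
open import Data.Sum.Base using (inj₁; inj₂)
open import Function.Base using (_∘_)
open import Function.Bundles using (Inverse; Equivalence; mk⇔)
open import Function.Definitions using (Injective)
open import Algebra.Bundles using (CommutativeRing)
import Algebra.Properties.CommutativeMonoid.Sum
import Algebra.Properties.CommutativeSemigroup
import Algebra.Properties.Ring
import Algebra.Properties.Semiring.Mult
import Algebra.Properties.Semiring.Sum
open import Relation.Binary.Bundles using (Poset)
import Relation.Binary.Construct.NonStrictToStrict
open import Relation.Binary.Definitions using (tri<; tri≈; tri>)
open import Relation.Binary.PropositionalEquality using (_≡_; refl; sym; trans; cong; cong₂; subst; subst₂; module ≡-Reasoning)
import Relation.Binary.Reasoning.PartialOrder
open import Relation.Binary.Structures using (IsDecTotalOrder)
open import Relation.Nullary using (yes; no; does; proof; Reflects; invert; ¬_; contradiction)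
open import Relation.Nullary.Decidable using (_×-dec_; ¬?; dec-true)
open import Relation.Unary using (Pred; Decidable)
open import Defs

module ∑ℕₚ = Algebra.Properties.CommutativeMonoid.Sum ℕₚ.+-0-commutativeMonoid

-- Binomial coefficients

-- The absorption identity, by induction on `n` through Pascal's rule. Splitting `(k+2) * b` as
-- `b + (k+1) * b` leaves two products, and the induction hypothesis applies to each of them, at `k`
-- and at `k+1`.
[k+1]*[n+1]C[k+1]≡[n+1]*nCk : ∀ n k → suc k ℕ.* (suc n C suc k) ≡ suc n ℕ.* (n C k)
[k+1]*[n+1]C[k+1]≡[n+1]*nCk zero    zero    = refl
[k+1]*[n+1]C[k+1]≡[n+1]*nCk zero    (suc k) = ℕₚ.*-zeroʳ k
[k+1]*[n+1]C[k+1]≡[n+1]*nCk (suc n) zero    = begin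
  1 ℕ.* (suc (suc n) C 1)      ≡⟨ ℕₚ.*-identityˡ _ ⟩
  suc (suc n) C 1              ≡⟨ nC1≡n (suc (suc n)) ⟩
  suc (suc n)                  ≡⟨ ℕₚ.*-identityʳ _ ⟨
  suc (suc n) ℕ.* (suc n C 0)  ∎
  where open ≡-Reasoning
[k+1]*[n+1]C[k+1]≡[n+1]*nCk (suc n) (suc k) = begin
  suc (suc k) ℕ.* (suc (suc n) C suc (suc k))
    ≡⟨ cong (suc (suc k) ℕ.*_) (nCk+nC[k+1]≡[n+1]C[k+1] (suc n) (suc k)) ⟨
  suc (suc k) ℕ.* (b ℕ.+ (suc n C suc (suc k)))
    ≡⟨ ℕₚ.*-distribˡ-+ (suc (suc k)) b _ ⟩
  b ℕ.+ suc k ℕ.* b ℕ.+ suc (suc k) ℕ.* (suc n C suc (suc k))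
    ≡⟨ ℕₚ.+-assoc b _ _ ⟩
  b ℕ.+ (suc k ℕ.* b ℕ.+ suc (suc k) ℕ.* (suc n C suc (suc k)))
    ≡⟨ cong (b ℕ.+_) (cong₂ ℕ._+_ ([k+1]*[n+1]C[k+1]≡[n+1]*nCk n k)
                                  ([k+1]*[n+1]C[k+1]≡[n+1]*nCk n (suc k))) ⟩
  b ℕ.+ (suc n ℕ.* (n C k) ℕ.+ suc n ℕ.* (n C suc k))
    ≡⟨ cong (b ℕ.+_) (ℕₚ.*-distribˡ-+ (suc n) (n C k) _) ⟨
  b ℕ.+ suc n ℕ.* ((n C k) ℕ.+ (n C suc k))
    ≡⟨ cong (λ m → b ℕ.+ suc n ℕ.* m) (nCk+nC[k+1]≡[n+1]C[k+1] n k) ⟩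
  b ℕ.+ suc n ℕ.* b ∎
  where
  open ≡-Reasoning
  b : ℕ
  b = suc n C suc k

-- Adding `(k+1) * (n C k)` to the left side gives `(n+1) * (n C k)` by Pascal's rule and
-- absorption; subtracting it again leaves the factor `n ∸ k`. Products distribute over truncated
-- subtraction, so the case `k > n` is covered as well.
[k+1]*nC[k+1]≡[n∸k]*nCk : ∀ n k → suc k ℕ.* (n C suc k) ≡ (n ∸ k) ℕ.* (n C k)
[k+1]*nC[k+1]≡[n∸k]*nCk n k = begin
  suc k ℕ.* (n C suc k)
    ≡⟨ ℕₚ.m+n∸m≡n (suc k ℕ.* (n C k)) _ ⟨
  suc k ℕ.* (n C k) ℕ.+ suc k ℕ.* (n C suc k) ∸ suc k ℕ.* (n C k)
    ≡⟨ cong (_∸ suc k ℕ.* (n C k)) (ℕₚ.*-distribˡ-+ (suc k) (n C k) _) ⟨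
  suc k ℕ.* ((n C k) ℕ.+ (n C suc k)) ∸ suc k ℕ.* (n C k)
    ≡⟨ cong (λ m → suc k ℕ.* m ∸ suc k ℕ.* (n C k)) (nCk+nC[k+1]≡[n+1]C[k+1] n k) ⟩
  suc k ℕ.* (suc n C suc k) ∸ suc k ℕ.* (n C k)
    ≡⟨ cong (_∸ suc k ℕ.* (n C k)) ([k+1]*[n+1]C[k+1]≡[n+1]*nCk n k) ⟩
  suc n ℕ.* (n C k) ∸ suc k ℕ.* (n C k)
    ≡⟨ ℕₚ.*-distribʳ-∸ (n C k) (suc n) (suc k) ⟨
  (n ∸ k) ℕ.* (n C k) ∎
  where open ≡-Reasoning

-- Both sides equal `(k+1) * (suc n C suc k)`. With `k` the smallest size `h`, this ratio of
-- consecutive binomials cancels the averaging factor of vertex deletion.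
[n+1∸k]*[n+1]Ck≡[n+1]*nCk : ∀ n k → (suc n ∸ k) ℕ.* (suc n C k) ≡ suc n ℕ.* (n C k)
[n+1∸k]*[n+1]Ck≡[n+1]*nCk n k =
  trans (sym ([k+1]*nC[k+1]≡[n∸k]*nCk (suc n) k)) ([k+1]*[n+1]C[k+1]≡[n+1]*nCk n k)

0<nCk : ∀ {n k} → k ℕ.≤ n → 0 ℕ.< n C k
0<nCk z≤n             = s≤s z≤n
0<nCk {suc n} {suc k} (s≤s k≤n) = ℕₚ.≤-trans (0<nCk k≤n)
  (ℕₚ.≤-trans (ℕₚ.m≤m+n (n C k) _) (ℕₚ.≤-reflexive (nCk+nC[k+1]≡[n+1]C[k+1] n k)))

nCk≤n^k : ∀ n k → n C k ℕ.≤ n ℕ.^ k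
nCk≤n^k n zero    = ℕₚ.≤-refl
nCk≤n^k n (suc k) = begin
  n C suc k                ≤⟨ ℕₚ.m≤n*m (n C suc k) (suc k) ⟩
  suc k ℕ.* (n C suc k)    ≡⟨ [k+1]*nC[k+1]≡[n∸k]*nCk n k ⟩
  (n ∸ k) ℕ.* (n C k)      ≤⟨ ℕₚ.*-mono-≤ (ℕₚ.m∸n≤m n k) (nCk≤n^k n k) ⟩
  n ℕ.* n ℕ.^ k            ∎
  where open ℕₚ.≤-Reasoning

n≤2*[n∸k] : ∀ {n k} → 2 ℕ.* k ℕ.≤ n → n ℕ.≤ 2 ℕ.* (n ∸ k)
n≤2*[n∸k] {n} {k} 2k≤n = begin
  n                      ≡⟨ ℕₚ.m+n∸n≡m n n ⟨
  n ℕ.+ n ∸ n            ≤⟨ ℕₚ.∸-monoʳ-≤ (n ℕ.+ n) 2k≤n ⟩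
  n ℕ.+ n ∸ 2 ℕ.* k      ≡⟨ cong (λ m → n ℕ.+ m ∸ 2 ℕ.* k) (ℕₚ.+-identityʳ n) ⟨
  2 ℕ.* n ∸ 2 ℕ.* k      ≡⟨ ℕₚ.*-distribˡ-∸ 2 n k ⟨
  2 ℕ.* (n ∸ k)          ∎
  where open ℕₚ.≤-Reasoning

-- Each of the `k` factors `n, n-1, ..., n-k+1` of `k! * (n C k)` is at least `n/2` once `n` is at
-- least `2k`.
n^k≤2^k*k!*nCk : ∀ {n} k → 2 ℕ.* k ℕ.≤ n → n ℕ.^ k ℕ.≤ 2 ℕ.^ k ℕ.* k ! ℕ.* (n C k)
n^k≤2^k*k!*nCk     zero    2k≤n = ℕₚ.≤-refl
n^k≤2^k*k!*nCk {n} (suc k) 2k≤n = begin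
  n ℕ.* n ℕ.^ k
    ≤⟨ ℕₚ.*-mono-≤ (n≤2*[n∸k] {k = k} 2k≤n′) (n^k≤2^k*k!*nCk k 2k≤n′) ⟩
  2 ℕ.* (n ∸ k) ℕ.* (2 ℕ.^ k ℕ.* k ! ℕ.* (n C k))
    ≡⟨ solve 5 (λ a b c d e → a :* b :* (c :* d :* e) := a :* c :* d :* (b :* e)) refl 2 (n ∸ k) (2 ℕ.^ k) (k !) (n C k) ⟩
  2 ℕ.* 2 ℕ.^ k ℕ.* k ! ℕ.* ((n ∸ k) ℕ.* (n C k))
    ≡⟨ cong (2 ℕ.* 2 ℕ.^ k ℕ.* k ! ℕ.*_) ([k+1]*nC[k+1]≡[n∸k]*nCk n k) ⟨
  2 ℕ.* 2 ℕ.^ k ℕ.* k ! ℕ.* (suc k ℕ.* (n C suc k))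
    ≡⟨ solve 4 (λ a b c d → a :* b :* (c :* d) := a :* (c :* b) :* d) refl (2 ℕ.^ suc k) (k !) (suc k) (n C suc k) ⟩
  2 ℕ.^ suc k ℕ.* suc k ! ℕ.* (n C suc k) ∎
  where
  open ℕₚ.≤-Reasoning
  open +-*-Solver
  2k≤n′ : 2 ℕ.* k ℕ.≤ n
  2k≤n′ = ℕₚ.≤-trans (ℕₚ.*-monoʳ-≤ 2 (ℕₚ.n≤1+n k)) 2k≤n

-- Counting subsets

private variable
  a p q : Level
  A B : Set a

indicator : Bool → ℕ
indicator b = if b then 1 else 0

count : {P : Pred A p} → Decidable P → List A → ℕ
count P? xs = length (filter P? xs)

module _ {P : Pred A p} (P? : Decidable P) where

  count-∷ : ∀ x xs → count P? (x ∷ xs) ≡ indicator (does (P? x)) ℕ.+ count P? xs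
  count-∷ x xs with does (P? x)
  ... | true  = refl
  ... | false = refl

  count-++ : ∀ xs ys → count P? (xs ++ ys) ≡ count P? xs ℕ.+ count P? ys
  count-++ xs ys = trans (cong length (Listₚ.filter-++ P? xs ys)) (Listₚ.length-++ (filter P? xs))

  count-map : (f : B → A) → ∀ xs → count P? (List.map f xs) ≡ count (P? ∘ f) xs
  count-map f []       = refl
  count-map f (x ∷ xs) with does (P? (f x))
  ... | true  = cong suc (count-map f xs)
  ... | false = count-map f xs

  count-map-++ : (f g : B → A) → ∀ xs →
                 count P? (List.map f xs ++ List.map g xs) ≡ count (P? ∘ f) xs ℕ.+ count (P? ∘ g) xs
  count-map-++ f g xs = trans (count-++ (List.map f xs) (List.map g xs))
                              (cong₂ ℕ._+_ (count-map f xs) (count-map g xs))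

  count-∅ : (∀ x → ¬ P x) → ∀ xs → count P? xs ≡ 0
  count-∅ ¬P []       = refl
  count-∅ ¬P (x ∷ xs) with P? x
  ... | yes px = contradiction px (¬P x)
  ... | no  _  = count-∅ ¬P xs

count-mono : {P : Pred A p} {Q : Pred A q} (P? : Decidable P) (Q? : Decidable Q) →
             (∀ x → P x → Q x) → ∀ xs → count P? xs ℕ.≤ count Q? xs
count-mono P? Q? P⊆Q []       = z≤n
count-mono P? Q? P⊆Q (x ∷ xs) with P? x | Q? x
... | yes _  | yes _  = s≤s (count-mono P? Q? P⊆Q xs)
... | yes px | no ¬qx = contradiction (P⊆Q x px) ¬qx
... | no  _  | yes _  = ℕₚ.m≤n⇒m≤1+n (count-mono P? Q? P⊆Q xs)
... | no  _  | no  _  = count-mono P? Q? P⊆Q xs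

∑ℕ-mono : ∀ {n} {f g : Fin n → ℕ} → (∀ i → f i ℕ.≤ g i) → ∑ℕ f ℕ.≤ ∑ℕ g
∑ℕ-mono {zero}  f≤g = z≤n
∑ℕ-mono {suc n} f≤g = ℕₚ.+-mono-≤ (f≤g zero) (∑ℕ-mono (f≤g ∘ suc))

∈-subsets : ∀ {n} (S : Subset n) → S ∈ˡ subsets n
∈-subsets []            = Any.here refl
∈-subsets (inside  ∷ S) = ∈-++⁺ˡ (∈-map⁺ (inside ∷_) (∈-subsets S))
∈-subsets (outside ∷ S) = ∈-++⁺ʳ _ (∈-map⁺ (outside ∷_) (∈-subsets S))

-- Inserting `outside` at `x` embeds the subsets of `n` points among those of `n + 1` points. The
-- induction on `x` follows the split of `subsets` by first entry: at `zero` the left side is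
-- precisely the `outside` half.
count-insertAt : ∀ {n} (x : Fin (suc n)) {P : Pred (Subset (suc n)) p} (P? : Decidable P) →
                 count (λ S → P? (insertAt S x outside)) (subsets n) ℕ.≤ count P? (subsets (suc n))
count-insertAt {n = n} zero P? = ℕₚ.≤-trans (ℕₚ.m≤n+m _ _)
  (ℕₚ.≤-reflexive (sym (count-map-++ P? (inside ∷_) (outside ∷_) (subsets n))))
count-insertAt {n = suc n} (suc x) P? = subst₂ ℕ._≤_
  (sym (count-map-++ (λ S → P? (insertAt S (suc x) outside)) (inside ∷_) (outside ∷_) (subsets n)))
  (sym (count-map-++ P? (inside ∷_) (outside ∷_) (subsets (suc n))))
  (ℕₚ.+-mono-≤ (count-insertAt x (P? ∘ (inside ∷_))) (count-insertAt x (P? ∘ (outside ∷_))))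

-- Pascal's rule mirrors the split of `subsets` into sets with and without the first point.
count-size : ∀ n h → count (λ S → ∣ S ∣ ℕₚ.≟ h) (subsets n) ≡ n C h
count-size zero    zero    = refl
count-size zero    (suc h) = refl
count-size (suc n) zero    = trans (count-map-++ (λ S → ∣ S ∣ ℕₚ.≟ 0) (inside ∷_) (outside ∷_) (subsets n))
  (cong₂ ℕ._+_ (count-∅ (λ S → suc ∣ S ∣ ℕₚ.≟ 0) (λ _ ()) (subsets n)) (count-size n zero))
count-size (suc n) (suc h) =
  trans (count-map-++ (λ S → ∣ S ∣ ℕₚ.≟ suc h) (inside ∷_) (outside ∷_) (subsets n))
 (trans (cong₂ ℕ._+_
    (cong length (Listₚ.filter-≐ (λ S → suc ∣ S ∣ ℕₚ.≟ suc h) (λ S → ∣ S ∣ ℕₚ.≟ h)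
                                 (ℕₚ.suc-injective , cong suc) (subsets n)))
    refl)
 (trans (cong₂ ℕ._+_ (count-size n h) (count-size n (suc h)))
        (nCk+nC[k+1]≡[n+1]C[k+1] n h)))

∑-outside : ∀ {m} (S : Subset m) → ∑ℕ (λ x → indicator (does (¬? (x ∈? S)))) ≡ ∣ ∁ S ∣
∑-outside []            = refl
∑-outside (inside  ∷ S) = ∑-outside S
∑-outside (outside ∷ S) = cong suc (∑-outside S)

module _ {n h : ℕ} {P : Pred (Subset n) p} (P? : Decidable P) (h≤ : ∀ {S} → P S → h ℕ.≤ ∣ S ∣) where

  avoiding? : ∀ x → Decidable (λ S → P S × x ∉ S)
  avoiding? x S = P? S ×-dec ¬? (x ∈? S)

  -- A set with at least `h` elements is avoided by at most `n ∸ h` points. A lower bound on the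
  -- size, rather than its value, lets one `h` serve graphs of different orders.
  ∑-avoiding : ∀ S → ∑ℕ (λ x → indicator (does (avoiding? x S))) ℕ.≤ (n ∸ h) ℕ.* indicator (does (P? S))
  ∑-avoiding S with P? S
  ... | no  _  = ℕₚ.≤-trans (ℕₚ.≤-reflexive (∑ℕₚ.sum-replicate-zero n)) z≤n
  -- Once `P S` is decided, each summand reduces to the test `x ∉ S`, so the sum is the size of the
  -- complement.
  ... | yes pS = ℕₚ.≤-trans (ℕₚ.≤-reflexive (trans (∑-outside S) (∣∁p∣≡n∸∣p∣ S)))
                (ℕₚ.≤-trans (ℕₚ.∸-monoʳ-≤ n (h≤ pS)) (ℕₚ.≤-reflexive (sym (ℕₚ.*-identityʳ _))))

  -- Double counting of the pairs of a point `x` and a listed set satisfying `P` that avoids it, one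
  -- set at a time.
  ∑-count-avoiding : ∀ Ss → ∑ℕ (λ x → count (avoiding? x) Ss) ℕ.≤ (n ∸ h) ℕ.* count P? Ss
  ∑-count-avoiding []       = ℕₚ.≤-trans (ℕₚ.≤-reflexive (∑ℕₚ.sum-replicate-zero n)) z≤n
  ∑-count-avoiding (S ∷ Ss) = begin
    ∑ℕ (λ x → count (avoiding? x) (S ∷ Ss))
      ≡⟨ ∑ℕₚ.sum-cong-≗ (λ x → count-∷ (avoiding? x) S Ss) ⟩
    ∑ℕ (λ x → indicator (does (avoiding? x S)) ℕ.+ count (avoiding? x) Ss)
      ≡⟨ ∑ℕₚ.∑-distrib-+ (λ x → indicator (does (avoiding? x S))) _ ⟩
    ∑ℕ (λ x → indicator (does (avoiding? x S))) ℕ.+ ∑ℕ (λ x → count (avoiding? x) Ss)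
      ≤⟨ ℕₚ.+-mono-≤ (∑-avoiding S) (∑-count-avoiding Ss) ⟩
    (n ∸ h) ℕ.* indicator (does (P? S)) ℕ.+ (n ∸ h) ℕ.* count P? Ss
      ≡⟨ ℕₚ.*-distribˡ-+ (n ∸ h) (indicator (does (P? S))) _ ⟨
    (n ∸ h) ℕ.* (indicator (does (P? S)) ℕ.+ count P? Ss)
      ≡⟨ cong ((n ∸ h) ℕ.*_) (count-∷ P? S Ss) ⟨
    (n ∸ h) ℕ.* count P? (S ∷ Ss) ∎
    where open ℕₚ.≤-Reasoning

-- Enumeration of the elements of a subset

elements : ∀ {n} (S : Subset n) → Fin ∣ S ∣ → Fin n
elements (inside  ∷ S) zero    = zero
elements (inside  ∷ S) (suc i) = suc (elements S i)
elements (outside ∷ S) i       = suc (elements S i)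

elements-injective : ∀ {n} (S : Subset n) → Injective _≡_ _≡_ (elements S)
elements-injective (inside  ∷ S) {zero}  {zero}  eq = refl
elements-injective (inside  ∷ S) {suc i} {suc j} eq = cong suc (elements-injective S (Finₚ.suc-injective eq))
elements-injective (outside ∷ S) eq = elements-injective S (Finₚ.suc-injective eq)

elements∈ : ∀ {n} (S : Subset n) i → elements S i ∈ S
elements∈ (inside  ∷ S) zero    = here
elements∈ (inside  ∷ S) (suc i) = there (elements∈ S i)
elements∈ (outside ∷ S) i       = there (elements∈ S i)

elements-surjective : ∀ {n} {S : Subset n} {x} → x ∈ S → ∃[ i ] elements S i ≡ x
elements-surjective here = zero , refl
elements-surjective {S = inside  ∷ S} (there x∈) = let i , eq = elements-surjective x∈ in suc i , cong suc eq
elements-surjective {S = outside ∷ S} (there x∈) = let i , eq = elements-surjective x∈ in i , cong suc eq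

-- Vertex deletion and the copies of a single graph

∉-insertAt : ∀ {n} (S : Subset n) x → x ∉ insertAt S x outside
∉-insertAt S x x∈ with () ← trans (sym (Vecₚ.insertAt-lookup S x outside)) (Vecₚ.[]=⇒lookup x∈)

punchIn-mono-< : ∀ {n} x {i j : Fin n} → i < j → punchIn x i < punchIn x j
punchIn-mono-< x {i} {j} i<j = Finₚ.≤∧≢⇒< (Finₚ.punchIn-mono-≤ x i j (ℕₚ.<⇒≤ i<j))
  (λ eq → Finₚ.<-irrefl (Finₚ.punchIn-injective x i j eq) i<j)

monochromatic : ∀ {k} n → Fin k → Coloring k n
monochromatic n c _ _ _ = c

-- The vertices other than `x` are renumbered by `punchIn x`, which respects their order, so
-- order-preserving copies stay order-preserving.
delete : ∀ {k n} → Coloring k (suc n) → Fin (suc n) → Coloring k n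
delete χ x i j i<j = χ (punchIn x i) (punchIn x j) (punchIn-mono-< x i<j)

module _ (H : OrderedGraph) where
  open OrderedGraph H
  open Inverse vertices using (to; from; strictlyInverseʳ; strictlyInverseˡ)

  vertex-injective : ∀ {i j} → from i ≡ from j → i ≡ j
  vertex-injective {i} {j} eq = trans (sym (strictlyInverseˡ i)) (trans (cong to eq) (strictlyInverseˡ j))

  label-injective : ∀ {x y} → to x ≡ to y → x ≡ y
  label-injective {x} {y} eq = trans (sym (strictlyInverseʳ x)) (trans (cong from eq) (strictlyInverseʳ y))

  module _ {k n : ℕ} {χ : Coloring k n} {c : Fin k} where

    MonoCopy⇒v≤n : MonoCopy H χ c → v ℕ.≤ n
    MonoCopy⇒v≤n f = Finₚ.injective⇒≤ (vertex-injective ∘ MonoCopy.injective f)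

    -- There are injections both ways: an element of `S` goes to its preimage under the copy, and a
    -- vertex to the place of its image in the enumeration of `S`.
    SupportsCopy⇒∣S∣≡v : ∀ {S} → SupportsCopy H χ c S → ∣ S ∣ ≡ v
    SupportsCopy⇒∣S∣≡v {S} (f , image) = ℕₚ.≤-antisym
      (Finₚ.injective⇒≤ {f = to ∘ proj₁ ∘ preimage} λ {i} {j} eq → elements-injective S
        (trans (sym (proj₂ (preimage i)))
        (trans (cong map (label-injective eq)) (proj₂ (preimage j)))))
      (Finₚ.injective⇒≤ {f = proj₁ ∘ position} λ {i} {j} eq → vertex-injective (injective
        (trans (sym (proj₂ (position i)))
        (trans (cong (elements S) eq) (proj₂ (position j))))))
      where
      open MonoCopy f

      preimage : ∀ i → ∃[ x ] map x ≡ elements S i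
      preimage i = Equivalence.to (image _) (elements∈ S i)

      position : ∀ i → ∃[ j ] elements S j ≡ map (from i)
      position i = elements-surjective (Equivalence.from (image _) (from i , refl))

    MonoCopy⇒SupportsCopy : MonoCopy H χ c → ∃ (SupportsCopy H χ c)
    MonoCopy⇒SupportsCopy f = S , f , λ a → mk⇔ (∈-S⁻ a) λ fx≡a →
        Vecₚ.lookup⇒[]= a S (trans (Vecₚ.lookup∘tabulate _ a) (dec-true (inImage? a) fx≡a))
      where
      open MonoCopy f

      inImage? : ∀ a → _
      inImage? a = any-V? H {k = 0} {n = 0} λ x → map x Finₚ.≟ a

      S : Subset n
      S = Vec.tabulate (does ∘ inImage?)

      ∈-S⁻ : ∀ a → a ∈ S → ∃[ x ] map x ≡ a
      -- Membership says that the decision `inImage? a` is `true`; its reflection proof then yields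
      -- the preimage.
      ∈-S⁻ a a∈S = invert (subst (Reflects _)
        (trans (sym (Vecₚ.lookup∘tabulate (does ∘ inImage?) a)) (Vecₚ.[]=⇒lookup a∈S))
        (proof (inImage? a)))

    MonoCopy⇒0<copies : MonoCopy H χ c → 0 ℕ.< copies H χ c
    MonoCopy⇒0<copies f = let S , supports = MonoCopy⇒SupportsCopy f in
      ∈-length (∈-filter⁺ (supportsCopy? H χ c) (∈-subsets S) supports)

    copies≤binomial : copies H χ c ℕ.≤ n C v
    copies≤binomial = ℕₚ.≤-trans
      (count-mono (supportsCopy? H χ c) (λ S → ∣ S ∣ ℕₚ.≟ v) (λ _ → SupportsCopy⇒∣S∣≡v) (subsets n))
      (ℕₚ.≤-reflexive (count-size n v))

  -- A single edge suffices: its image would have both colors `c` and `d`. The order of its ends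
  -- decides which orientation is used.
  copies-monochromatic : HasEdge H → ∀ {k} n {c d : Fin k} → ¬ d ≡ c → copies H (monochromatic n d) c ≡ 0
  copies-monochromatic (x , y , adj) n {c} {d} d≢c =
    count-∅ (supportsCopy? H (monochromatic n d) c) (λ _ → noCopy ∘ proj₁) (subsets n)
    where
    noCopy : ¬ MonoCopy H (monochromatic n d) c
    noCopy f with compare x y
    ... | tri< x≺y _ _  = d≢c (MonoCopy.color f adj (MonoCopy.monotone f x≺y))
    ... | tri≈ _ x≡y _  = Adj-irrefl x≡y adj
    ... | tri> _ _ y≺x  = d≢c (MonoCopy.color f (Adj-sym adj) (MonoCopy.monotone f y≺x))

  module _ {k n : ℕ} (χ : Coloring k (suc n)) (c : Fin k) where

    -- The copy is composed with `punchIn x`, whose range misses exactly `x`.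
    SupportsCopy-insertAt : ∀ x {S} → SupportsCopy H (delete χ x) c S → SupportsCopy H χ c (insertAt S x outside)
    SupportsCopy-insertAt x {S} (f , image) = f′ , λ a → mk⇔ (⇒ a) (⇐ a)
      where
      open MonoCopy f

      f′ : MonoCopy H χ c
      f′ = record
        { map       = punchIn x ∘ map
        ; injective = injective ∘ Finₚ.punchIn-injective x _ _
        ; monotone  = punchIn-mono-< x ∘ monotone
        ; color     = λ {y} {z} adj lt →
            -- The given inequality is between renumbered vertices, while `delete` expects one
            -- between the original ones and rebuilds its own proof; irrelevance of `<` identifies
            -- the two colors.
            let le  = Finₚ.punchIn-cancel-≤ x (map y) (map z) (ℕₚ.<⇒≤ lt)
                lt′ = Finₚ.≤∧≢⇒< le (λ eq → Finₚ.<-irrefl (cong (punchIn x) eq) lt)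
            in trans (cong (χ _ _) (Finₚ.<-irrelevant lt _)) (color adj lt′)
        }

      ⇒ : ∀ a → a ∈ insertAt S x outside → ∃[ y ] punchIn x (map y) ≡ a
      ⇒ a a∈ with x Finₚ.≟ a
      ... | yes refl = contradiction a∈ (∉-insertAt S x)
      ... | no  x≢a  =
        let y , eq = Equivalence.to (image (punchOut x≢a)) (Vecₚ.lookup⇒[]= _ S
              (trans (sym (Vecₚ.insertAt-punchIn S x outside (punchOut x≢a)))
                     (Vecₚ.[]=⇒lookup (subst (_∈ insertAt S x outside) (sym (Finₚ.punchIn-punchOut x≢a)) a∈))))
        in y , trans (cong (punchIn x) eq) (Finₚ.punchIn-punchOut x≢a)

      ⇐ : ∀ a → ∃[ y ] punchIn x (map y) ≡ a → a ∈ insertAt S x outside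
      ⇐ _ (y , refl) = Vecₚ.lookup⇒[]= _ _ (trans (Vecₚ.insertAt-punchIn S x outside (map y))
        (Vecₚ.[]=⇒lookup (Equivalence.from (image (map y)) (y , refl))))

    -- For each `x` the copies surviving its deletion embed among the copies avoiding `x`; double
    -- counting bounds the sum of the latter.
    ∑-copies-delete : ∀ {h} → h ℕ.≤ v →
                      ∑ℕ (λ x → copies H (delete χ x) c) ℕ.≤ (suc n ∸ h) ℕ.* copies H χ c
    ∑-copies-delete {h} h≤v = ℕₚ.≤-trans
      (∑ℕ-mono λ x → ℕₚ.≤-trans
        (count-mono (supportsCopy? H (delete χ x) c) (λ S → avoiding? H? h≤ x (insertAt S x outside))
                    (λ S supports → SupportsCopy-insertAt x supports , ∉-insertAt S x) (subsets n))
        (count-insertAt x (avoiding? H? h≤ x)))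
      (∑-count-avoiding H? h≤ (subsets (suc n)))
      where
      H? : Decidable (SupportsCopy H χ c)
      H? = supportsCopy? H χ c

      h≤ : ∀ {S} → SupportsCopy H χ c S → h ℕ.≤ ∣ S ∣
      h≤ supports = ℕₚ.≤-trans h≤v (ℕₚ.≤-reflexive (sym (SupportsCopy⇒∣S∣≡v supports)))

-- Ordered fields

module CompleteOrderedFieldProperties {c ℓ₁ ℓ₂} (ℝ : CompleteOrderedField c ℓ₁ ℓ₂) where
  open CompleteOrderedField ℝ
  open CommutativeRing commutativeRing public
    using (ring; semiring; +-cong; +-congˡ; *-cong; *-congˡ; *-congʳ; +-comm; +-assoc; *-comm; *-assoc;
           +-identityˡ; +-identityʳ; *-identityˡ; *-identityʳ; distribʳ; zeroˡ; zeroʳ; -‿inverseʳ; -‿inverseˡ)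
    renaming (refl to ≈-refl; sym to ≈-sym; trans to ≈-trans; reflexive to ≈-reflexive)
  open IsDecTotalOrder isDecTotalOrder public
    using (total; antisym; _≤?_; ≤-respˡ-≈; ≤-respʳ-≈) renaming (refl to ≤-refl; trans to ≤-trans; reflexive to ≤-reflexive)
  open Algebra.Properties.Semiring.Mult semiring using (×-homo-+; ×1-homo-*)
  module ∑ₚ = Algebra.Properties.Semiring.Sum semiring
  module *ₚ = Algebra.Properties.CommutativeSemigroup (CommutativeRing.*-commutativeSemigroup commutativeRing)
  open Algebra.Properties.Ring ring

  poset : Poset c ℓ₁ ℓ₂
  poset = record { isPartialOrder = IsDecTotalOrder.isPartialOrder isDecTotalOrder }

  module ≤-Reasoning = Relation.Binary.Reasoning.PartialOrder poset

  ≰⇒> : ∀ {x y} → ¬ x ≤ y → y <ᵣ x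
  ≰⇒> = Relation.Binary.Construct.NonStrictToStrict.≰⇒> _≈_ _≤_ ≈-sym ≤-reflexive total

  0<x⇒x≉0 : ∀ {x} → 0# <ᵣ x → ¬ x ≈ 0#
  0<x⇒x≉0 (_ , 0≉x) x≈0 = 0≉x (≈-sym x≈0)

  +-monoʳ-≤ : ∀ {x y} z → x ≤ y → z + x ≤ z + y
  +-monoʳ-≤ {x} {y} z x≤y = begin
    z + x ≈⟨ +-comm z x ⟩
    x + z ≤⟨ +-monoˡ-≤ z x≤y ⟩
    y + z ≈⟨ +-comm y z ⟩
    z + y ∎
    where open ≤-Reasoning

  +-mono-≤ : ∀ {x y u v} → x ≤ y → u ≤ v → x + u ≤ y + v
  +-mono-≤ x≤y u≤v = ≤-trans (+-monoˡ-≤ _ x≤y) (+-monoʳ-≤ _ u≤v)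

  x≤x+y : ∀ {x y} → 0# ≤ y → x ≤ x + y
  x≤x+y 0≤y = ≤-trans (≤-reflexive (≈-sym (+-identityʳ _))) (+-monoʳ-≤ _ 0≤y)

  y≤x+y : ∀ {x y} → 0# ≤ x → y ≤ x + y
  y≤x+y 0≤x = ≤-trans (x≤x+y 0≤x) (≤-reflexive (+-comm _ _))

  x≤y⇒0≤y-x : ∀ {x y} → x ≤ y → 0# ≤ y - x
  x≤y⇒0≤y-x {x} x≤y = ≤-trans (≤-reflexive (≈-sym (-‿inverseʳ x))) (+-monoˡ-≤ (- x) x≤y)

  0≤y-x⇒x≤y : ∀ {x y} → 0# ≤ y - x → x ≤ y
  0≤y-x⇒x≤y {x} {y} 0≤y-x = begin
    x             ≤⟨ y≤x+y 0≤y-x ⟩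
    y - x + x     ≈⟨ +-assoc y (- x) x ⟩
    y + (- x + x) ≈⟨ +-congˡ (-‿inverseˡ x) ⟩
    y + 0#        ≈⟨ +-identityʳ y ⟩
    y             ∎
    where open ≤-Reasoning

  -- The axioms provide only products of nonnegative elements, so the claim is reduced to
  -- nonnegativity of `(y - x) * z`.
  *-monoʳ-≤ : ∀ {x y} z → 0# ≤ z → x ≤ y → x * z ≤ y * z
  *-monoʳ-≤ {x} {y} z 0≤z x≤y = 0≤y-x⇒x≤y
    (≤-respʳ-≈ ([y-z]x≈yx-zx z y x) (*-nonneg (x≤y⇒0≤y-x x≤y) 0≤z))

  *-monoˡ-≤ : ∀ {x y} z → 0# ≤ z → x ≤ y → z * x ≤ z * y
  *-monoˡ-≤ {x} {y} z 0≤z x≤y = begin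
    z * x ≈⟨ *-comm z x ⟩
    x * z ≤⟨ *-monoʳ-≤ z 0≤z x≤y ⟩
    y * z ≈⟨ *-comm y z ⟩
    z * y ∎
    where open ≤-Reasoning

  -- If `1 ≤ 0` then `-1` is nonnegative, and so is its square `1`.
  0<1 : 0# <ᵣ 1#
  0<1 with total 0# 1#
  ... | inj₁ 0≤1 = 0≤1 , 0≉1
  ... | inj₂ 1≤0 = contradiction (antisym 0≤1 1≤0) 0≉1
    where
    0≤-1 : 0# ≤ - 1#
    0≤-1 = ≤-respʳ-≈ (+-identityˡ (- 1#)) (x≤y⇒0≤y-x 1≤0)

    0≤1 : 0# ≤ 1#
    0≤1 = ≤-respʳ-≈ (≈-trans (-1*x≈-x (- 1#)) (-‿involutive 1#)) (*-nonneg 0≤-1 0≤-1)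

  0<x⇒0<x⁻¹ : ∀ {x} → 0# <ᵣ x → 0# <ᵣ x ⁻¹
  0<x⇒0<x⁻¹ {x} 0<x = ≰⇒> λ x⁻¹≤0 → proj₂ 0<1 (antisym (proj₁ 0<1) (begin
    1#          ≈⟨ ⁻¹-inverse x (0<x⇒x≉0 0<x) ⟨
    x * x ⁻¹    ≤⟨ *-monoˡ-≤ x (proj₁ 0<x) x⁻¹≤0 ⟩
    x * 0#      ≈⟨ zeroʳ x ⟩
    0#          ∎))
    where open ≤-Reasoning

  x*y/y≈x : ∀ {x y} → 0# <ᵣ y → x * y / y ≈ x
  x*y/y≈x {x} {y} 0<y = begin-equality
    x * y * y ⁻¹    ≈⟨ *-assoc x y (y ⁻¹) ⟩
    x * (y * y ⁻¹)  ≈⟨ *-congˡ (⁻¹-inverse y (0<x⇒x≉0 0<y)) ⟩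
    x * 1#          ≈⟨ *-identityʳ x ⟩
    x               ∎
    where open ≤-Reasoning

  x/y*y≈x : ∀ {x y} → 0# <ᵣ y → x / y * y ≈ x
  x/y*y≈x {x} {y} 0<y = ≈-trans (*ₚ.xy∙z≈xz∙y x (y ⁻¹) y) (x*y/y≈x 0<y)

  -- Dividing by `y` turns `0 ≈ x * y` into `0 ≈ x`.
  *-pos : ∀ {x y} → 0# <ᵣ x → 0# <ᵣ y → 0# <ᵣ x * y
  *-pos {x} {y} 0<x 0<y = *-nonneg (proj₁ 0<x) (proj₁ 0<y) , λ 0≈xy → proj₂ 0<x (begin-equality
    0#        ≈⟨ zeroˡ (y ⁻¹) ⟨
    0# / y    ≈⟨ *-congʳ 0≈xy ⟩
    x * y / y ≈⟨ x*y/y≈x 0<y ⟩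
    x         ∎)
    where open ≤-Reasoning

  /-pos : ∀ {x y} → 0# <ᵣ x → 0# <ᵣ y → 0# <ᵣ x / y
  /-pos 0<x 0<y = *-pos 0<x (0<x⇒0<x⁻¹ 0<y)

  x≤y*z⇒x/z≤y : ∀ {x y z} → 0# <ᵣ z → x ≤ y * z → x / z ≤ y
  x≤y*z⇒x/z≤y {z = z} 0<z x≤y*z =
    ≤-trans (*-monoʳ-≤ (z ⁻¹) (proj₁ (0<x⇒0<x⁻¹ 0<z)) x≤y*z) (≤-reflexive (x*y/y≈x 0<z))

  x*z≤y⇒x≤y/z : ∀ {x y z} → 0# <ᵣ z → x * z ≤ y → x ≤ y / z
  x*z≤y⇒x≤y/z {z = z} 0<z x*z≤y =
    ≤-trans (≤-reflexive (≈-sym (x*y/y≈x 0<z))) (*-monoʳ-≤ (z ⁻¹) (proj₁ (0<x⇒0<x⁻¹ 0<z)) x*z≤y)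

  cross-≤ : ∀ {x y u v} → 0# <ᵣ y → 0# <ᵣ v → x * v ≤ u * y → x / y ≤ u / v
  cross-≤ {x} {y} {u} {v} 0<y 0<v x*v≤u*y = x≤y*z⇒x/z≤y 0<y
    (≤-trans (x*z≤y⇒x≤y/z 0<v x*v≤u*y) (≤-reflexive (*ₚ.xy∙z≈xz∙y u y (v ⁻¹))))

  *-cancelˡ-≤ : ∀ {x y z} → 0# <ᵣ z → z * x ≤ z * y → x ≤ y
  *-cancelˡ-≤ {x} {y} {z} 0<z zx≤zy = begin
    x          ≤⟨ x*z≤y⇒x≤y/z 0<z (≤-respˡ-≈ (*-comm z x) zx≤zy) ⟩
    z * y / z  ≈⟨ *-congʳ (*-comm z y) ⟩
    y * z / z  ≈⟨ x*y/y≈x 0<z ⟩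
    y          ∎
    where open ≤-Reasoning

  x<x+y : ∀ x {y} → 0# <ᵣ y → x <ᵣ x + y
  x<x+y x {y} (0≤y , 0≉y) = x≤x+y 0≤y , λ x≈x+y → 0≉y
    (≈-sym (+-cancelˡ x y 0# (≈-trans (≈-sym x≈x+y) (≈-sym (+-identityʳ x)))))

  x-y<x : ∀ x {y} → 0# <ᵣ y → x - y <ᵣ x
  x-y<x x {y} 0<y = begin-strict
    x - y       <⟨ x<x+y (x - y) 0<y ⟩
    x - y + y   ≈⟨ +-assoc x (- y) y ⟩
    x + (- y + y) ≈⟨ +-congˡ (-‿inverseˡ y) ⟩
    x + 0#      ≈⟨ +-identityʳ x ⟩
    x           ∎
    where open ≤-Reasoning

  -- Natural numbers and finite sums in the field

  fromℕ-+ : ∀ m n → fromℕ (m ℕ.+ n) ≈ fromℕ m + fromℕ n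
  fromℕ-+ = ×-homo-+ 1#

  fromℕ-* : ∀ m n → fromℕ (m ℕ.* n) ≈ fromℕ m * fromℕ n
  fromℕ-* = ×1-homo-*

  fromℕ-nonneg : ∀ n → 0# ≤ fromℕ n
  fromℕ-nonneg zero    = ≤-refl
  fromℕ-nonneg (suc n) = ≤-trans (fromℕ-nonneg n) (y≤x+y (proj₁ 0<1))

  fromℕ-mono-≤ : ∀ {m n} → m ℕ.≤ n → fromℕ m ≤ fromℕ n
  fromℕ-mono-≤ {n = n} z≤n = fromℕ-nonneg n
  fromℕ-mono-≤ (s≤s m≤n)   = +-monoʳ-≤ 1# (fromℕ-mono-≤ m≤n)

  fromℕ-pos : ∀ {n} → 0 ℕ.< n → 0# <ᵣ fromℕ n
  fromℕ-pos {suc n} _ = begin-strict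
    0#               <⟨ 0<1 ⟩
    1#               ≤⟨ x≤x+y (fromℕ-nonneg n) ⟩
    1# + fromℕ n     ∎
    where open ≤-Reasoning

  ∑-mono-≤ : ∀ {n} {f g : Fin n → Carrier} → (∀ i → f i ≤ g i) → ∑ f ≤ ∑ g
  ∑-mono-≤ {zero}  f≤g = ≤-refl
  ∑-mono-≤ {suc n} f≤g = +-mono-≤ (f≤g zero) (∑-mono-≤ (f≤g ∘ suc))

  ∑-nonneg : ∀ {n} {f : Fin n → Carrier} → (∀ i → 0# ≤ f i) → 0# ≤ ∑ f
  ∑-nonneg {n} 0≤f = ≤-trans (≤-reflexive (≈-sym (∑ₚ.sum-replicate-zero n))) (∑-mono-≤ 0≤f)

  term≤∑ : ∀ {n} {f : Fin n → Carrier} → (∀ i → 0# ≤ f i) → ∀ i → f i ≤ ∑ f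
  term≤∑ 0≤f zero    = x≤x+y (∑-nonneg (0≤f ∘ suc))
  term≤∑ 0≤f (suc i) = ≤-trans (term≤∑ (0≤f ∘ suc) i) (y≤x+y (0≤f zero))

  ∑-cong : ∀ {n} {f g : Fin n → Carrier} → (∀ i → f i ≈ g i) → ∑ f ≈ ∑ g
  ∑-cong = ∑ₚ.sum-cong-≋

  ∑-const : ∀ n x → ∑ {n} (λ _ → x) ≈ fromℕ n * x
  ∑-const zero    x = ≈-sym (zeroˡ x)
  ∑-const (suc n) x = begin-equality
    x + ∑ {n} (λ _ → x)      ≈⟨ +-cong (≈-sym (*-identityˡ x)) (∑-const n x) ⟩
    1# * x + fromℕ n * x     ≈⟨ distribʳ x 1# (fromℕ n) ⟨
    (1# + fromℕ n) * x       ∎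
    where open ≤-Reasoning

  ∑-only : ∀ {n} {f : Fin n → Carrier} i → (∀ j → ¬ j ≡ i → f j ≈ 0#) → ∑ f ≈ f i
  ∑-only {suc n} {f} zero    f≈0 = ≈-trans
    (+-congˡ (≈-trans (∑-cong (λ j → f≈0 (suc j) λ ())) (∑ₚ.sum-replicate-zero n))) (+-identityʳ (f zero))
  ∑-only {suc n} {f} (suc i) f≈0 = ≈-trans
    (+-cong (f≈0 zero λ ()) (∑-only i (λ j j≢i → f≈0 (suc j) (j≢i ∘ Finₚ.suc-injective)))) (+-identityˡ _)

  fromℕ-∑ : ∀ {n} (f : Fin n → ℕ) → fromℕ (∑ℕ f) ≈ ∑ (fromℕ ∘ f)
  fromℕ-∑ {zero}  f = ≈-refl
  fromℕ-∑ {suc n} f = ≈-trans (fromℕ-+ (f zero) _) (+-congˡ (fromℕ-∑ (f ∘ suc)))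

  -- The limit is the supremum of the values from `n₀` on. That it dominates each of them is kept in
  -- the conclusion, to compare it with the first density.
  monotoneLimit : ∀ (a : ℕ → Carrier) n₀ b → (∀ m n → n₀ ℕ.≤ m → m ℕ.≤ n → a m ≤ a n) →
                  (∀ n → n₀ ℕ.≤ n → a n ≤ b) → ∃[ L ] (a ⟶ L) × (∀ n → n₀ ℕ.≤ n → a n ≤ L) × L ≤ b
  monotoneLimit a n₀ b mono bounded = L , converges , a≤L , L≤b
    where
    Value : Carrier → Set (c ⊔ ℓ₁ ⊔ ℓ₂)
    -- `Lift` raises the predicate to the universe level that `sup` quantifies over.
    Value x = Lift (c ⊔ ℓ₁ ⊔ ℓ₂) (∃[ n ] n₀ ℕ.≤ n × a n ≈ x)

    lub : ∃[ s ] (∀ x → Value x → x ≤ s) × (∀ y → y <ᵣ s → ∃[ x ] Value x × y <ᵣ x)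
    lub = sup Value (a n₀ , lift (n₀ , ℕₚ.≤-refl , ≈-refl))
                    (b , λ _ (lift (n , n₀≤n , an≈x)) → ≤-respˡ-≈ an≈x (bounded n n₀≤n))

    L : Carrier
    L = proj₁ lub

    a≤L : ∀ n → n₀ ℕ.≤ n → a n ≤ L
    a≤L n n₀≤n = proj₁ (proj₂ lub) (a n) (lift (n , n₀≤n , ≈-refl))

    approach : ∀ y → y <ᵣ L → ∃[ n ] n₀ ℕ.≤ n × y <ᵣ a n
    approach y y<L = let x , lift (n , n₀≤n , an≈x) , y≤x , y≉x = proj₂ (proj₂ lub) y y<L in
      n , n₀≤n , ≤-respʳ-≈ (≈-sym an≈x) y≤x , λ y≈an → y≉x (≈-trans y≈an an≈x)

    L≤b : L ≤ b
    -- If `b` were below `L`, the second clause of `sup` would give a term above `b`.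
    L≤b with L ≤? b
    ... | yes L≤b = L≤b
    ... | no  L≰b = let n , n₀≤n , b≤an , b≉an = approach b (≰⇒> L≰b) in
                    contradiction (antisym b≤an (bounded n n₀≤n)) b≉an

    converges : a ⟶ L
    -- Some term exceeds `L - ε`; by monotonicity all later ones do, and none exceeds `L`.
    converges ε 0<ε with N , n₀≤N , L-ε<aN ← approach (L - ε) (x-y<x L 0<ε) = N , λ n N≤n →
      (begin-strict
        L - ε  <⟨ L-ε<aN ⟩
        a N    ≤⟨ mono N n n₀≤N N≤n ⟩
        a n    ∎) ,
      (begin-strict
        a n    ≤⟨ a≤L n (ℕₚ.≤-trans n₀≤N N≤n) ⟩
        L      <⟨ x<x+y L 0<ε ⟩
        L + ε  ∎)
      where open ≤-Reasoning

-- Multiplicities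

module _ {c ℓ₁ ℓ₂} (ℝ : CompleteOrderedField c ℓ₁ ℓ₂) where
  open CompleteOrderedField ℝ
  open CompleteOrderedFieldProperties ℝ

  module MultiplicityProperties
    {k : ℕ} .{{_ : NonZero k}} (G : Fin k → OrderedGraph) (edges : ∀ i → HasEdge (G i))
    (λs : Fin k → Carrier) (0<λs : ∀ i → 0# <ᵣ λs i)
    where
    open Multiplicity G ℝ λs

    private
      R h : ℕ
      R = R̄ G
      h = h⋆ G

    h≤v : ∀ i → h ℕ.≤ OrderedGraph.v (G i)
    h≤v = proj₂ (proj₂ (smallestSize G))

    arrows : Arrows G R
    arrows = proj₁ (proj₂ (orderedRamsey G))

    -- Some `G i` embeds into `R` vertices, and it has at least `h` of them. Hence the denominators
    -- `n C h` are positive from `R` on.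
    h≤R : h ℕ.≤ R
    h≤R = let i , f = arrows (monochromatic R (someColor k)) in ℕₚ.≤-trans (h≤v i) (MonoCopy⇒v≤n (G i) f)

    0<binomial : ∀ {n} → h ℕ.≤ n → 0# <ᵣ fromℕ (n C h)
    0<binomial h≤n = fromℕ-pos (0<nCk h≤n)

    0<λ⋆ : 0# <ᵣ λ⋆
    0<λ⋆ = let (j , _) , λj≈λ⋆ = proj₁ (proj₂ smallestWeight) in begin-strict
      0#    <⟨ 0<λs j ⟩
      λs j  ≈⟨ λj≈λ⋆ ⟩
      λ⋆    ∎
      where open ≤-Reasoning

    M̄≤λ⋆*binomial : ∀ n → M̄ n ≤ λ⋆ * fromℕ (n C h)
    M̄≤λ⋆*binomial n = let (j , vj≡h) , λj≈λ⋆ = proj₁ (proj₂ smallestWeight) in begin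
      M̄ n
        ≤⟨ proj₂ (proj₂ (multiplicity n)) (monochromatic n j) ⟩
      weightedCopies (monochromatic n j)
        ≈⟨ ∑-only j (λ i i≢j → ≈-trans
             (*-congˡ (≈-reflexive (cong fromℕ (copies-monochromatic (G i) (edges i) n (i≢j ∘ sym)))))
             (zeroʳ (λs i))) ⟩
      λs j * fromℕ (copies (G j) (monochromatic n j) j)
        -- Copies are counted by their vertex sets, all of size `v (G j)`.
        ≤⟨ *-monoˡ-≤ (λs j) (proj₁ (0<λs j)) (fromℕ-mono-≤ (copies≤binomial (G j))) ⟩
      λs j * fromℕ (n C OrderedGraph.v (G j))
        ≈⟨ *-cong λj≈λ⋆ (≈-reflexive (cong (λ m → fromℕ (n C m)) vj≡h)) ⟩
      λ⋆ * fromℕ (n C h) ∎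
      where open ≤-Reasoning

    -- In a coloring attaining the minimum, `arrows` provides a copy for some `i`; that term is
    -- positive and the others are nonnegative.
    0<RM̄ : 0# <ᵣ RM̄
    0<RM̄ =
      let (χ , w≈M) , _ = proj₂ (multiplicity R)
          i , f = arrows χ
      in begin-strict
      0#
        <⟨ *-pos (0<λs i) (fromℕ-pos (MonoCopy⇒0<copies (G i) f)) ⟩
      λs i * fromℕ (copies (G i) χ i)
        ≤⟨ term≤∑ (λ j → *-nonneg (proj₁ (0<λs j)) (fromℕ-nonneg (copies (G j) χ j))) i ⟩
      weightedCopies χ
        ≈⟨ w≈M ⟩
      RM̄ ∎
      where open ≤-Reasoning

    -- Exchanging the sums reduces the bound to one color at a time. Since `h` is at most every
    -- order, `suc n ∸ h` is a common factor.
    ∑-weightedCopies-delete : ∀ {n} (χ : Coloring k (suc n)) →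
                              ∑ (λ x → weightedCopies (delete χ x)) ≤ fromℕ (suc n ∸ h) * weightedCopies χ
    ∑-weightedCopies-delete {n} χ = begin
      ∑ (λ x → ∑ λ i → λs i * fromℕ (N x i))
        ≈⟨ ∑ₚ.∑-comm (λ x i → λs i * fromℕ (N x i)) ⟩
      ∑ (λ i → ∑ λ x → λs i * fromℕ (N x i))
        ≈⟨ ∑-cong (λ i → ≈-sym (∑ₚ.*-distribˡ-sum (λs i) (λ x → fromℕ (N x i)))) ⟩
      ∑ (λ i → λs i * ∑ λ x → fromℕ (N x i))
        ≈⟨ ∑-cong (λ i → *-congˡ (≈-sym (fromℕ-∑ (λ x → N x i)))) ⟩
      ∑ (λ i → λs i * fromℕ (∑ℕ λ x → N x i))
        ≤⟨ ∑-mono-≤ (λ i → *-monoˡ-≤ (λs i) (proj₁ (0<λs i))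
                             (fromℕ-mono-≤ (∑-copies-delete (G i) χ i (h≤v i)))) ⟩
      ∑ (λ i → λs i * fromℕ ((suc n ∸ h) ℕ.* copies (G i) χ i))
        ≈⟨ ∑-cong (λ i → ≈-trans (*-congˡ (fromℕ-* (suc n ∸ h) _)) (*ₚ.x∙yz≈y∙xz (λs i) _ _)) ⟩
      ∑ (λ i → fromℕ (suc n ∸ h) * (λs i * fromℕ (copies (G i) χ i)))
        ≈⟨ ∑ₚ.*-distribˡ-sum (fromℕ (suc n ∸ h)) (λ i → λs i * fromℕ (copies (G i) χ i)) ⟨
      fromℕ (suc n ∸ h) * weightedCopies χ ∎
      where
      open ≤-Reasoning

      N : Fin (suc n) → Fin k → ℕ
      N x i = copies (G i) (delete χ x) i

    -- Take `χ` optimal on `n + 1` vertices: each of its `n + 1` deletions has weight at least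
    -- `M̄ n`.
    [n+1]*M̄n≤[n+1∸h]*M̄[n+1] : ∀ n → fromℕ (suc n) * M̄ n ≤ fromℕ (suc n ∸ h) * M̄ (suc n)
    [n+1]*M̄n≤[n+1∸h]*M̄[n+1] n = let (χ , w≈M) , _ = proj₂ (multiplicity (suc n)) in begin
      fromℕ (suc n) * M̄ n
        ≈⟨ ∑-const (suc n) (M̄ n) ⟨
      ∑ {suc n} (λ _ → M̄ n)
        ≤⟨ ∑-mono-≤ (λ x → proj₂ (proj₂ (multiplicity n)) (delete χ x)) ⟩
      ∑ (λ x → weightedCopies (delete χ x))
        ≤⟨ ∑-weightedCopies-delete χ ⟩
      fromℕ (suc n ∸ h) * weightedCopies χ
        ≈⟨ *-congˡ w≈M ⟩
      fromℕ (suc n ∸ h) * M̄ (suc n) ∎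
      where open ≤-Reasoning

    -- Densities and the order of growth

    density : ℕ → Carrier
    density n = M̄ n / fromℕ (n C h)

    -- The cross-multiplied inequality is scaled by `n + 1` to make the averaging bound applicable;
    -- the binomial identity then restores `n + 1` on the right, where it cancels.
    density-step : ∀ {n} → h ℕ.≤ n → density n ≤ density (suc n)
    density-step {n} h≤n = cross-≤ (0<binomial h≤n) (0<binomial (ℕₚ.m≤n⇒m≤1+n h≤n))
      (*-cancelˡ-≤ (fromℕ-pos {suc n} (s≤s z≤n)) (begin
        fromℕ (suc n) * (M̄ n * fromℕ (suc n C h))
          ≈⟨ *-assoc _ _ _ ⟨
        fromℕ (suc n) * M̄ n * fromℕ (suc n C h)
          ≤⟨ *-monoʳ-≤ _ (fromℕ-nonneg (suc n C h)) ([n+1]*M̄n≤[n+1∸h]*M̄[n+1] n) ⟩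
        fromℕ (suc n ∸ h) * M̄ (suc n) * fromℕ (suc n C h)
          ≈⟨ *ₚ.xy∙z≈y∙xz _ _ _ ⟩
        M̄ (suc n) * (fromℕ (suc n ∸ h) * fromℕ (suc n C h))
          ≈⟨ *-congˡ (fromℕ-* (suc n ∸ h) (suc n C h)) ⟨
        M̄ (suc n) * fromℕ ((suc n ∸ h) ℕ.* (suc n C h))
          ≡⟨ cong (λ m → M̄ (suc n) * fromℕ m) ([n+1∸k]*[n+1]Ck≡[n+1]*nCk n h) ⟩
        M̄ (suc n) * fromℕ (suc n ℕ.* (n C h))
          ≈⟨ *-congˡ (fromℕ-* (suc n) (n C h)) ⟩
        M̄ (suc n) * (fromℕ (suc n) * fromℕ (n C h))
          ≈⟨ *ₚ.x∙yz≈y∙xz _ _ _ ⟩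
        fromℕ (suc n) * (M̄ (suc n) * fromℕ (n C h)) ∎))
      where open ≤-Reasoning

    density-mono : ∀ m n → R ℕ.≤ m → m ℕ.≤ n → density m ≤ density n
    density-mono m n R≤m m≤n = go (ℕₚ.≤⇒≤′ m≤n)
      where
      go : ∀ {n} → m ℕ.≤′ n → density m ≤ density n
      go ℕ.≤′-refl       = ≤-refl
      go (ℕ.≤′-step m≤n) = ≤-trans (go m≤n)
        (density-step (ℕₚ.≤-trans h≤R (ℕₚ.≤-trans R≤m (ℕₚ.≤′⇒≤ m≤n))))

    density≤λ⋆ : ∀ n → R ℕ.≤ n → density n ≤ λ⋆
    density≤λ⋆ n R≤n = x≤y*z⇒x/z≤y (0<binomial (ℕₚ.≤-trans h≤R R≤n)) (M̄≤λ⋆*binomial n)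

    0<density[R] : 0# <ᵣ density R
    0<density[R] = /-pos 0<RM̄ (0<binomial h≤R)

    M̄=Θ[n^h] : M̄ =Θ (λ n → fromℕ (n ℕ.^ h))
    -- Beyond `R` the density is at least `density R`; beyond `2 * h` the power `n ^ h` is at most
    -- `K * (n C h)`. The upper constant `λ⋆` comes from `n C h` being at most `n ^ h`.
    M̄=Θ[n^h] = density R / K , λ⋆ , R ℕ.⊔ 2 ℕ.* h , /-pos 0<density[R] 0<K , 0<λ⋆ , λ n n₀≤n →
      lower n (ℕₚ.m⊔n≤o⇒m≤o R _ n₀≤n) (ℕₚ.m⊔n≤o⇒n≤o R _ n₀≤n) ,
      ≤-trans (M̄≤λ⋆*binomial n) (*-monoˡ-≤ λ⋆ (proj₁ 0<λ⋆) (fromℕ-mono-≤ (nCk≤n^k n h)))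
      where
      open ≤-Reasoning

      K : Carrier
      K = fromℕ (2 ℕ.^ h ℕ.* h !)

      0<K : 0# <ᵣ K
      0<K = fromℕ-pos (ℕₚ.*-mono-< (ℕₚ.m^n>0 2 h) (ℕₚ.1≤n! h))

      lower : ∀ n → R ℕ.≤ n → 2 ℕ.* h ℕ.≤ n → density R / K * fromℕ (n ℕ.^ h) ≤ M̄ n
      lower n R≤n 2h≤n = begin
        density R / K * fromℕ (n ℕ.^ h)
          ≤⟨ *-monoˡ-≤ _ (proj₁ (/-pos 0<density[R] 0<K)) (fromℕ-mono-≤ (n^k≤2^k*k!*nCk h 2h≤n)) ⟩
        density R / K * fromℕ (2 ℕ.^ h ℕ.* h ! ℕ.* (n C h))
          ≈⟨ *-congˡ (fromℕ-* (2 ℕ.^ h ℕ.* h !) (n C h)) ⟩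
        density R / K * (K * fromℕ (n C h))
          ≈⟨ *-assoc _ _ _ ⟨
        density R / K * K * fromℕ (n C h)
          ≈⟨ *-congʳ (x/y*y≈x 0<K) ⟩
        density R * fromℕ (n C h)
          ≤⟨ *-monoʳ-≤ _ (fromℕ-nonneg (n C h)) (density-mono R n ℕₚ.≤-refl R≤n) ⟩
        density n * fromℕ (n C h)
          ≈⟨ x/y*y≈x (0<binomial (ℕₚ.≤-trans h≤R R≤n)) ⟩
        M̄ n ∎

corollary2p3 :
    ∀ {c ℓ₁ ℓ₂} (ℝ : CompleteOrderedField c ℓ₁ ℓ₂) →
    let open CompleteOrderedField ℝ in
    (k : ℕ) .{{_ : NonZero k}}
    (G : Fin k → OrderedGraph) → (∀ i → HasEdge (G i)) →
    (λs : Fin k → Carrier) → (∀ i → 0# <ᵣ λs i) →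
    let open Multiplicity G ℝ λs
        R = R̄ G
        h = h⋆ G
    in
    (∀ m n → R ℕ.≤ m → m ℕ.≤ n → M̄ m / fromℕ (m C h) ≤ M̄ n / fromℕ (n C h)) ×
    (∀ n → R ℕ.≤ n → M̄ n / fromℕ (n C h) ≤ λ⋆) ×
    (∃[ π ] ((λ n → M̄ n / fromℕ (n C h)) ⟶ π) ×
            (0# <ᵣ RM̄ / fromℕ (R C h)) ×
            (RM̄ / fromℕ (R C h) ≤ π) ×
            (π ≤ λ⋆)) ×
    (M̄ =Θ (λ n → fromℕ (n ℕ.^ h)))
corollary2p3 ℝ k G edges λs 0<λs =
  -- The lower bound on `π` is domination of the term at `R̄ G`, which is by definition `RM̄` over
  -- its binomial.
  let π , converges , density≤π , π≤λ⋆ = monotoneLimit density (R̄ G) _ density-mono density≤λ⋆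
  in density-mono , density≤λ⋆ ,
     (π , converges , 0<density[R] , density≤π (R̄ G) ℕₚ.≤-refl , π≤λ⋆) , M̄=Θ[n^h]
  where
  open CompleteOrderedFieldProperties ℝ
  open MultiplicityProperties ℝ G edges λs 0<λs
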